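{- Let $H$ be a finite graph without multiple edges, possibly with loops, with no isolated vertices, and with maximum degree $\Delta$ (loops counting once toward the degree). Let $D \geq 1$. For any $G \in \mathcal{G}(n,1,D)$, \[ \hom(G,H) \leq \max \{ \hom(K_{2},H)^{\frac{n}{2}}, \hom(K_{1,D},H)^{\frac{n}{1+D}} \}, \] with the cases of equality being those of the corresponding theorem for $n$-vertex graphs ($n \geq 2$) of minimum degree $1$ with no maximum degree condition, where $K_{1,n-1}$ is replaced by $\frac{n}{1+D}K_{1,D}$. That is: \begin{enumerate} \item If $H \neq K_{\Delta}^{\text{loop}}$ satisfies $\hom(K_2,H) \geq \Delta^2$, then equality holds only for $G = \frac{n}{2}K_2$. \item If $H$ satisfies $\hom(K_2,H) < \Delta^2$, let $n_0 = n_0(H)$ be the smallest integer in $\{3,4,\ldots\}$ satisfying $\hom(K_2,H) < \hom(K_{1,n_0-1},H)^{\frac{2}{n_0}}$. \begin{enumerate} \item If $2 \leq n < n_0$, then equality holds only for $G = \frac{n}{2}K_2$ [unless $n = n_0-1$ and $\hom(K_2,H) = \hom(K_{1,n_0-2},H)^{\frac{2}{n_0-1}}$, in which case $G = \frac{n}{1+D}K_{1,D}$ also achieves equality]. \item If $n \geq n_0$, then equality holds only for $G = \frac{n}{1+D}K_{1,D}$. \end{enumerate} \end{enumerate}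
   Context: For a finite simple (loopless) graph $G$ and a finite graph $H$ (no multiple edges, loops allowed), $\hom(G,H)$ is the number of maps $f:V(G)\to V(H)$ such that $v\sim_G w$ implies $f(v)\sim_H f(w)$. For $v\in V(H)$, $d(v)$ is the degree of $v$, where a loop counts once; $\Delta=\max_{v\in V(H)} d(v)$. A vertex of $H$ is isolated if it is incident to no edge and no loop. $\mathcal{G}(n,\delta,D)$ is the set of graphs on $n$ vertices (finite, simple) with minimum degree $\delta$ and maximum degree at most $D$. $K_\Delta^{\text{loop}}$ is the fully looped complete graph on $\Delta$ vertices. $K_2$ is a single edge, and $K_{a,b}$ is the complete bipartite graph with parts of sizes $a$ and $b$. For a $k$-vertex graph $F$, $\frac{n}{k}F$ is the disjoint union of $n/k$ copies of $F$.
   Formalization: In case 2, n is compared with n_0 in the English; here 1+D is (as written 2(b) fails: H=K_{1,3}, D=2, n=6, G=3K_2). In the tie case 1+D=n_0-1, both named graphs attain equality, and equality forces G to be a disjoint union of copies of K_2 and K_{1,D}. -}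

module Defs where

open import Data.Bool using (Bool)
import Data.Bool.Properties as Bool
open import Data.Fin using (Fin; toℕ; splitAt; finToFun)
open import Data.Fin.Properties using (_≟_; all?)
open import Data.List using (allFin; filter; length; map)
open import Data.List.Extrema.Nat using (max)
open import Data.Nat using (ℕ; zero; suc; _+_; _*_; _∸_; _^_; _⊔_; _≤_; _<_; _<ᵇ_)
open import Data.Product using (Σ; ∃; ∃₂; _×_; _,_)
open import Data.Sum.Relation.Binary.Pointwise
  using (Pointwise; inj₁; inj₂; ⊎-symmetric; ⊎-decidable)
open import Data.Unit using (⊤; tt)
open import Function using (_⇔_; _↔_; Inverse)
open import Level using (0ℓ)
open import Relation.Binary using (Rel; Symmetric; Decidable)
open import Relation.Binary.PropositionalEquality using (_≡_; _≢_; refl; ≢-sym)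
open import Relation.Nullary using (Dec; yes; no; ¬_; ¬?; _→-dec_)

-- Loops are allowed: nothing is assumed about Adj v v.
record Graph (n : ℕ) : Set₁ where
  field
    Adj     : Rel (Fin n) 0ℓ
    adj-sym : Symmetric Adj
    adj?    : Decidable Adj

open Graph public

record SimpleGraph (n : ℕ) : Set₁ where
  field
    graph    : Graph n
    loopless : ∀ v → ¬ Adj graph v v

open SimpleGraph public

-- A loop at v makes v its own neighbour, so it contributes exactly one.
degree : ∀ {n} → Graph n → Fin n → ℕ
degree G v = length (filter (adj? G v) (allFin _))

maxDegree : ∀ {n} → Graph n → ℕ
maxDegree G = max 0 (map (degree G) (allFin _))

Isolated : ∀ {n} → Graph n → Fin n → Set
Isolated G v = ∀ w → ¬ Adj G v w

NoIsolated : ∀ {n} → Graph n → Set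
NoIsolated G = ∀ v → ¬ Isolated G v

-- The minimum is required to be attained, so δ is the exact minimum degree;
-- in particular the graph has at least one vertex.
MinDegree : ∀ {n} → Graph n → ℕ → Set
MinDegree G δ = (∀ v → δ ≤ degree G v) × ∃ λ v → degree G v ≡ δ

-- Membership in 𝒢(n, δ, D).
𝒢 : (n δ D : ℕ) → SimpleGraph n → Set
𝒢 n δ D G = MinDegree (graph G) δ × maxDegree (graph G) ≤ D

infix 4 _≅_

_≅_ : ∀ {m n} → Graph m → Graph n → Set
_≅_ {m} {n} G H =
  Σ (Fin m ↔ Fin n) λ φ → ∀ v w → Adj G v w ⇔ Adj H (Inverse.to φ v) (Inverse.to φ w)

IsHom : ∀ {n m} → Graph n → Graph m → (Fin n → Fin m) → Set
IsHom G H f = ∀ v w → Adj G v w → Adj H (f v) (f w)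

isHom? : ∀ {n m} (G : Graph n) (H : Graph m) (f : Fin n → Fin m) → Dec (IsHom G H f)
isHom? G H f = all? λ v → all? λ w → adj? G v w →-dec adj? H (f v) (f w)

-- finToFun enumerates each of the m ^ n maps Fin n → Fin m exactly once.
hom : ∀ {n m} → SimpleGraph n → Graph m → ℕ
hom {n} {m} G H =
  length (filter (λ i → isHom? (graph G) H (finToFun i)) (allFin (m ^ n)))

Kˡᵒᵒᵖ : ∀ n → Graph n
Kˡᵒᵒᵖ n = record { Adj = λ _ _ → ⊤ ; adj-sym = λ _ → tt ; adj? = λ _ _ → yes tt }

K : ∀ n → SimpleGraph n
K n = record
  { graph    = record { Adj = _≢_ ; adj-sym = ≢-sym ; adj? = λ v w → ¬? (v ≟ w) }
  ; loopless = λ v v≢v → v≢v refl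
  }

-- The first a vertices form one part and the remaining b vertices the other.
K[_,_] : ∀ a b → SimpleGraph (a + b)
K[ a , b ] = record
  { graph    = record
    { Adj     = λ v w → side v ≢ side w
    ; adj-sym = ≢-sym
    ; adj?    = λ v w → ¬? (side v Bool.≟ side w)
    }
  ; loopless = λ v s≢s → s≢s refl
  }
  where
  side : Fin (a + b) → Bool
  side v = toℕ v <ᵇ a

infixr 5 _⊕_

-- Disjoint union.
_⊕_ : ∀ {m n} → SimpleGraph m → SimpleGraph n → SimpleGraph (m + n)
_⊕_ {m} {n} F G = record
  { graph    = record
    { Adj     = λ v w → Adj⊎ (splitAt m v) (splitAt m w)
    ; adj-sym = ⊎-symmetric (adj-sym (graph F)) (adj-sym (graph G))
    ; adj?    = λ v w → ⊎-decidable (adj? (graph F)) (adj? (graph G)) (splitAt m v) (splitAt m w)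
    }
  ; loopless = λ v → irr (splitAt m v)
  }
  where
  Adj⊎ = Pointwise (Adj (graph F)) (Adj (graph G))

  irr : ∀ x → ¬ Adj⊎ x x
  irr _ (inj₁ e) = loopless F _ e
  irr _ (inj₂ e) = loopless G _ e

copies : ∀ {k} c → SimpleGraph k → SimpleGraph (c * k)
copies zero    F = K 0
copies (suc c) F = F ⊕ copies c F

-- G = (n/k) F.  An isomorphism forces n ≡ c * k, so c is n/k, and the
-- statement fails when k does not divide n.
_IsCopiesOf_ : ∀ {n k} → SimpleGraph n → SimpleGraph k → Set
G IsCopiesOf F = ∃ λ c → graph G ≅ graph (copies c F)

_IsUnionOfCopiesOf_And_ : ∀ {n k l} → SimpleGraph n → SimpleGraph k → SimpleGraph l → Set
G IsUnionOfCopiesOf E And F = ∃₂ λ a b → graph G ≅ graph (copies a E ⊕ copies b F)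

-- Fractional powers are cleared by raising both sides of
--   hom(G,H) ≤ max { hom(K₂,H)^(n/2) , hom(K_{1,D},H)^(n/(1+D)) }
-- to the power 2(1+D), which is strictly increasing on nonnegative reals and
-- so preserves max, inequality and equality.
boundPower : ∀ {m} → Graph m → (n D : ℕ) → ℕ
boundPower H n D = hom (K 2) H ^ (n * (1 + D)) ⊔ hom K[ 1 , D ] H ^ (n * 2)

Bounded : ∀ {n m} → SimpleGraph n → Graph m → ℕ → Set
Bounded {n} G H D = hom G H ^ (2 * (1 + D)) ≤ boundPower H n D

Equality : ∀ {n m} → SimpleGraph n → Graph m → ℕ → Set
Equality {n} G H D = hom G H ^ (2 * (1 + D)) ≡ boundPower H n D

-- hom(K₂,H) < hom(K_{1,k-1},H)^(2/k), raised to the power k.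
StarBeatsEdge : ∀ {m} → Graph m → ℕ → Set
StarBeatsEdge H k = hom (K 2) H ^ k < hom K[ 1 , k ∸ 1 ] H ^ 2

-- n₀ is the least k ≥ 3 with StarBeatsEdge H k.
IsThreshold : ∀ {m} → Graph m → ℕ → Set
IsThreshold H n₀ =
  3 ≤ n₀ × StarBeatsEdge H n₀ × (∀ k → 3 ≤ k → StarBeatsEdge H k → n₀ ≤ k)

-- The borderline case: the star K_{1,D} has n₀ - 1 vertices, and
-- hom(K₂,H) = hom(K_{1,n₀-2},H)^(2/(n₀-1)), raised to the power n₀ - 1.
-- Then K₂ and K_{1,D} have the same per-vertex count, so every union
-- a K₂ ⊎ b K_{1,D} attains the bound, not only those with a = 0 or b = 0.
Tie : ∀ {m} → Graph m → (n₀ D : ℕ) → Set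
Tie H n₀ D = 1 + D ≡ n₀ ∸ 1 × hom (K 2) H ^ (n₀ ∸ 1) ≡ hom K[ 1 , n₀ ∸ 2 ] H ^ 2

{-# OPTIONS --safe #-}

-- A graph G without isolated vertices contains a spanning forest of stars K[1,k] with 1 ≤ k ≤ D, so that
-- hom(G,H) ≤ ∏ hom(K[1,k],H), and hom(K[1,k],H) is the power sum u k = ∑ d(v)^k over the degrees of H. By
-- Cauchy–Schwarz u is log-convex, which makes k ↦ u k ^ (1 / (k + 1)) decrease and then increase: its maximum
-- over 1 ≤ k ≤ D is at k = 1 or k = D. If hom(K₂,H) ≥ Δ² then u k ≤ Δ^(k-1) u 1 puts the maximum at k = 1;
-- if hom(K₂,H) < Δ² then H is not regular, log-convexity is strict, and n₀ decides between the two ends.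
-- In the case of equality all stars are extremal, and G has no edge outside the forest because each
-- additional edge excludes some homomorphism of the forest.

module Submission where

open import Defs
open import Data.Bool using (true; false; if_then_else_)
open import Data.Fin using (Fin; zero; suc; splitAt; join; finToFun; funToFin; combine; _↑ˡ_; _↑ʳ_; cast)
open import Data.Fin.Permutation using (cast-id; ↔⇒≡)
open import Data.Fin.Properties
  using (_≟_; all?; any?; ¬∀⟶∃¬; splitAt-↑ˡ; splitAt-↑ʳ; join-splitAt; remQuot-combine;
         funToFin-finToFin; finToFun-funToFin; +↔⊎)
open import Data.List as List using (List; []; _∷_; _++_; length; allFin)
open import Data.List.Extrema.Nat using (xs≤max; argmax-sel)
open import Data.List.Membership.Propositional using (_∈_)
open import Data.List.Membership.Propositional.Properties using (∈-++⁻; ∈-∃++; ∈-allFin; ∈-map⁺; ∈-map⁻)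
open import Data.List.Properties using (length-tabulate; ++-identityʳ)
open import Data.List.Relation.Binary.Permutation.Propositional
  using (_↭_; prep; swap; ↭-refl; ↭-sym; ↭-trans; ↭-reflexive; ↭⇒↭ₛ; module PermutationReasoning)
open import Data.List.Relation.Binary.Permutation.Propositional.Properties
  using (shift; ++⁺ˡ; ++⁺ʳ; ∈-resp-↭; All-resp-↭; ↭-length)
import Data.List.Relation.Binary.Permutation.Setoid as Permutation
import Data.List.Relation.Binary.Permutation.Setoid.Properties as Permutation
open import Data.List.Relation.Unary.All as All using (All; []; _∷_)
open import Data.List.Relation.Unary.Any using (here; there)
open import Data.Nat hiding (_≟_)
open import Data.Nat.Properties hiding (_≟_)
open import Data.Nat.Tactic.RingSolver using (solve-∀)
open import Data.Product using (Σ; ∃; _×_; _,_; proj₁; proj₂)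
open import Data.Sum as Sum using (_⊎_; inj₁; inj₂; [_,_]′)
open import Data.Sum.Algebra using (⊎-comm; ⊎-assoc)
open import Data.Sum.Function.Propositional using (_⊎-↔_)
open import Data.Sum.Properties using ([,]-map)
open import Data.Sum.Relation.Binary.Pointwise using (Pointwise; inj₁; inj₂)
open import Data.Vec as Vec using (Vec)
open import Data.Vec.Functional as F using (Vector)
open import Data.Vec.Properties using (lookup-splitAt; toList-++; toList∘fromList; length-toList)
open import Function using (_∘_; id; _⇔_; _↔_; mk⇔; mk↔ₛ′; Inverse; Equivalence)
open import Function.Properties.Inverse using (↔-refl; ↔-sym; ↔-trans)
open import Level using (0ℓ)
open import Relation.Binary using (Rel)
open import Relation.Binary.PropositionalEquality hiding ([_])
open import Relation.Nullary using (Dec; yes; no; does; ¬_; ¬?; _×-dec_; contradiction; decidable-stable)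
open import Algebra.Properties.Semiring.Sum +-*-semiring
open Inverse using (to; from; strictlyInverseˡ; strictlyInverseʳ)

-- After taking logarithms, the root of `u k` of order k + 1 is the slope of the line from the point
-- (-1, 0) to (k, log (u k)). Seen from a fixed point on their left, the slopes to the points of a
-- convex graph first fall and then rise; over the naturals these slopes are compared by
-- cross-multiplied exponents. In the case of equality the delicate edges of G are those joining two
-- leaves of one star. Their images share a neighbour in H, so such an edge excludes nothing when
-- every neighbourhood in H is a looped clique, for instance when H is a disjoint union of looped
-- complete graphs. Such an H has hom(K₂,H) ≥ Δ², where the extremal stars are single edges and have
-- no two leaves. If hom(K₂,H) < Δ², some neighbourhood in H contains a non-adjacent pair. An edge
-- between different stars is excluded as soon as H has any non-adjacent pair, which is why the
-- fully looped complete graph is set apart.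

private
  variable
    a b c d k l m n : ℕ

-- Counting

𝟙 : {P : Set} → Dec P → ℕ
𝟙 P? = if does P? then 1 else 0

𝟙-yes : {P : Set} (P? : Dec P) → P → 𝟙 P? ≡ 1
𝟙-yes (yes _) _ = refl
𝟙-yes (no ¬p) p = contradiction p ¬p

𝟙-no : {P : Set} (P? : Dec P) → ¬ P → 𝟙 P? ≡ 0
𝟙-no (yes p) ¬p = contradiction p ¬p
𝟙-no (no _)  _  = refl

𝟙-≤1 : {P : Set} (P? : Dec P) → 𝟙 P? ≤ 1
𝟙-≤1 (yes _) = ≤-refl
𝟙-≤1 (no _)  = z≤n

𝟙-mono : {P Q : Set} (P? : Dec P) (Q? : Dec Q) → (P → Q) → 𝟙 P? ≤ 𝟙 Q?
𝟙-mono (yes p) Q? f = ≤-reflexive (sym (𝟙-yes Q? (f p)))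
𝟙-mono (no _)  Q? f = z≤n

𝟙-cong : {P Q : Set} (P? : Dec P) (Q? : Dec Q) → (P → Q) → (Q → P) → 𝟙 P? ≡ 𝟙 Q?
𝟙-cong P? Q? f g = ≤-antisym (𝟙-mono P? Q? f) (𝟙-mono Q? P? g)

𝟙-× : {P Q R : Set} (P? : Dec P) (Q? : Dec Q) (R? : Dec R) →
      (R → P × Q) → (P → Q → R) → 𝟙 R? ≡ 𝟙 P? * 𝟙 Q?
𝟙-× (yes p) (yes q) R? f g = 𝟙-yes R? (g p q)
𝟙-× (yes p) (no ¬q) R? f g = 𝟙-no R? (¬q ∘ proj₂ ∘ f)
𝟙-× (no ¬p) _       R? f g = 𝟙-no R? (¬p ∘ proj₁ ∘ f)

length-filter-tabulate : {A : Set} {P : A → Set} (P? : ∀ x → Dec (P x)) (f : Fin n → A) →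
  List.length (List.filter P? (List.tabulate f)) ≡ ∑[ i < n ] 𝟙 (P? (f i))
length-filter-tabulate {zero}  P? f = refl
length-filter-tabulate {suc n} P? f with does (P? (f zero))
... | true  = cong suc (length-filter-tabulate P? (f ∘ suc))
... | false = length-filter-tabulate P? (f ∘ suc)

∑-mono : {f g : Vector ℕ n} → (∀ i → f i ≤ g i) → sum f ≤ sum g
∑-mono {zero}  f≤g = z≤n
∑-mono {suc n} f≤g = +-mono-≤ (f≤g zero) (∑-mono (f≤g ∘ suc))

∑-mono-< : {f g : Vector ℕ n} → (∀ i → f i ≤ g i) → ∀ i → f i < g i → sum f < sum g
∑-mono-< f≤g zero    f<g = +-mono-<-≤ f<g (∑-mono (f≤g ∘ suc))
∑-mono-< f≤g (suc i) f<g = +-mono-≤-< (f≤g zero) (∑-mono-< (f≤g ∘ suc) i f<g)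

term≤∑ : (f : Vector ℕ n) → ∀ i → f i ≤ sum f
term≤∑ f zero    = m≤m+n _ _
term≤∑ f (suc i) = ≤-trans (term≤∑ (f ∘ suc) i) (m≤n+m _ _)

∑-const : ∀ n x → ∑[ _ < n ] x ≡ n * x
∑-const zero    x = refl
∑-const (suc n) x = cong (x +_) (∑-const n x)

∑-↑ : ∀ a (f : Vector ℕ (a + b)) → sum f ≡ ∑[ i < a ] f (i ↑ˡ b) + ∑[ j < b ] f (a ↑ʳ j)
∑-↑ zero    f = refl
∑-↑ (suc a) f = trans (cong (f zero +_) (∑-↑ a (f ∘ suc))) (sym (+-assoc (f zero) _ _))

∑-combine : ∀ a (f : Vector ℕ (a * b)) → sum f ≡ ∑[ i < a ] ∑[ j < b ] f (combine i j)
∑-combine         zero    f = refl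
∑-combine {b = b} (suc a) f = trans (∑-↑ b f) (cong (∑[ j < b ] f (j ↑ˡ _) +_) (∑-combine a _))

-- Sums over functions

-- Decoding an encoded function returns it only up to pointwise equality, so a sum over codes can be
-- reindexed only if its summand respects `≗`.
Extensional : ((Fin n → Fin m) → ℕ) → Set
Extensional g = ∀ {f f′} → f ≗ f′ → g f ≡ g f′

∑ᶠ : ∀ n {m} → ((Fin n → Fin m) → ℕ) → ℕ
∑ᶠ n {m} g = ∑[ i < m ^ n ] g (finToFun i)

∑ᶠ-cong : ∀ n {m} {g h : (Fin n → Fin m) → ℕ} → (∀ f → g f ≡ h f) → ∑ᶠ n g ≡ ∑ᶠ n h
∑ᶠ-cong n eq = sum-cong-≗ (eq ∘ finToFun)

funToFin-cong : {f g : Fin n → Fin m} → f ≗ g → funToFin f ≡ funToFin g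
funToFin-cong {zero}  f≗g = refl
funToFin-cong {suc n} f≗g = cong₂ combine (f≗g zero) (funToFin-cong (f≗g ∘ suc))

funRelabel : ∀ m → Fin k ↔ Fin l → Fin (m ^ k) ↔ Fin (m ^ l)
funRelabel {k} {l} m φ = mk↔ₛ′
  (λ i → funToFin (finToFun i ∘ from φ))
  (λ i → funToFin (finToFun i ∘ to φ))
  (λ i → trans (funToFin-cong λ v → trans (finToFun-funToFin (finToFun i ∘ to φ) (from φ v)) (cong (finToFun i) (strictlyInverseˡ φ v)))
               (funToFin-finToFin {l} {m} i))
  (λ i → trans (funToFin-cong λ v → trans (finToFun-funToFin (finToFun i ∘ from φ) (to φ v)) (cong (finToFun i) (strictlyInverseʳ φ v)))
               (funToFin-finToFin {k} {m} i))

∑ᶠ-relabel : (φ : Fin k ↔ Fin l) (g : (Fin l → Fin m) → ℕ) → Extensional g →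
  ∑ᶠ l g ≡ ∑ᶠ k (λ f → g (f ∘ from φ))
∑ᶠ-relabel {m = m} φ g ext = trans (∑-permute (g ∘ finToFun) (funRelabel m φ))
  (sum-cong-≗ λ i → ext (finToFun-funToFin (finToFun i ∘ from φ)))

∑ᶠ-suc : ∀ n (g : (Fin (suc n) → Fin m) → ℕ) → Extensional g →
  ∑ᶠ (suc n) g ≡ ∑[ x < m ] ∑ᶠ n (λ f → g (x F.∷ f))
∑ᶠ-suc {m} n g ext = trans (∑-combine m _) (sum-cong-≗ λ x → sum-cong-≗ λ j → ext (λ where
  zero    → cong proj₁ (remQuot-combine x j)
  (suc v) → cong (λ p → finToFun (proj₂ p) v) (remQuot-combine x j)))

∷-++ : (x : Fin m) (f : Vector (Fin m) a) (h : Vector (Fin m) b) → ((x F.∷ f) F.++ h) ≗ (x F.∷ (f F.++ h))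
∷-++ x f h zero    = refl
∷-++ {a = a} x f h (suc i) = [,]-map (splitAt a i)

++-cong : {f f′ : Vector (Fin m) a} {h h′ : Vector (Fin m) b} → f ≗ f′ → h ≗ h′ → (f F.++ h) ≗ (f′ F.++ h′)
++-cong {a = a} p q i with splitAt a i
... | inj₁ j = p j
... | inj₂ j = q j

∷-cong : ∀ {x : Fin m} {f f′ : Vector (Fin m) a} → f ≗ f′ → (x F.∷ f) ≗ (x F.∷ f′)
∷-cong p zero    = refl
∷-cong p (suc i) = p i

∑ᶠ-++ : ∀ a b (g : (Fin (a + b) → Fin m) → ℕ) → Extensional g →
  ∑ᶠ (a + b) g ≡ ∑ᶠ a (λ f → ∑ᶠ b (λ h → g (f F.++ h)))
∑ᶠ-++ zero    b g ext = sym (+-identityʳ _)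
∑ᶠ-++ {m} (suc a) b g ext = begin
  ∑ᶠ (suc (a + b)) g
    ≡⟨ ∑ᶠ-suc (a + b) g ext ⟩
  ∑[ x < m ] ∑ᶠ (a + b) (λ f → g (x F.∷ f))
    ≡⟨ sum-cong-≗ (λ x → ∑ᶠ-++ a b (λ f → g (x F.∷ f)) (λ p → ext (∷-cong p))) ⟩
  ∑[ x < m ] ∑ᶠ a (λ f → ∑ᶠ b (λ h → g (x F.∷ (f F.++ h))))
    ≡⟨ sum-cong-≗ (λ x → ∑ᶠ-cong a λ f → ∑ᶠ-cong b λ h → ext (sym ∘ ∷-++ x f h)) ⟩
  ∑[ x < m ] ∑ᶠ a (λ f → ∑ᶠ b (λ h → g ((x F.∷ f) F.++ h)))
    ≡⟨ ∑ᶠ-suc a (λ f → ∑ᶠ b (λ h → g (f F.++ h))) (λ p → ∑ᶠ-cong b λ h → ext (++-cong {h = h} p (λ _ → refl))) ⟨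
  ∑ᶠ (suc a) (λ f → ∑ᶠ b (λ h → g (f F.++ h))) ∎
  where open ≡-Reasoning

-- Homomorphism counts

𝟙-hom : SimpleGraph n → Graph m → (Fin n → Fin m) → ℕ
𝟙-hom G H f = 𝟙 (isHom? (graph G) H f)

IsHom-cong : (G : Graph n) (H : Graph m) {f g : Fin n → Fin m} → f ≗ g → IsHom G H f → IsHom G H g
IsHom-cong G H f≗g h v w e = subst₂ (Adj H) (f≗g v) (f≗g w) (h v w e)

𝟙-hom-ext : (G : SimpleGraph n) (H : Graph m) → Extensional (𝟙-hom G H)
𝟙-hom-ext G H {f} {g} p = 𝟙-cong (isHom? (graph G) H f) (isHom? (graph G) H g)
  (IsHom-cong (graph G) H p) (IsHom-cong (graph G) H (sym ∘ p))

hom-∑ᶠ : (G : SimpleGraph n) (H : Graph m) → hom G H ≡ ∑ᶠ n (𝟙-hom G H)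
hom-∑ᶠ G H = length-filter-tabulate (λ i → isHom? (graph G) H (finToFun i)) id

degree-∑ : (G : Graph n) (v : Fin n) → degree G v ≡ ∑[ w < n ] 𝟙 (adj? G v w)
degree-∑ G v = length-filter-tabulate (adj? G v) id

-- One direction only: `φ` exhibits F as a spanning subgraph of G.
PreservesAdj : Graph k → Graph l → Fin k ↔ Fin l → Set
PreservesAdj F G φ = ∀ v w → Adj F v w → Adj G (to φ v) (to φ w)

module _ (F : SimpleGraph k) (G : SimpleGraph l) (H : Graph m) (φ : Fin k ↔ Fin l)
         (φ-adj : PreservesAdj (graph F) (graph G) φ) where

  private
    pull : ∀ f → IsHom (graph G) H (f ∘ from φ) → IsHom (graph F) H f
    pull f h v w e = subst₂ (λ x y → Adj H (f x) (f y)) (strictlyInverseʳ φ v) (strictlyInverseʳ φ w)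
      (h _ _ (φ-adj v w e))

    term : ∀ f → 𝟙-hom G H (f ∘ from φ) ≤ 𝟙-hom F H f
    term f = 𝟙-mono (isHom? (graph G) H _) (isHom? (graph F) H f) (pull f)

    homG : hom G H ≡ ∑ᶠ k (λ f → 𝟙-hom G H (f ∘ from φ))
    homG = trans (hom-∑ᶠ G H) (∑ᶠ-relabel φ (𝟙-hom G H) (𝟙-hom-ext G H))

  -- Extra edges are extra constraints: a homomorphism from G, pulled back along `φ`, is one from
  -- the spanning subgraph F.
  hom-anti : hom G H ≤ hom F H
  hom-anti = ≤-trans (≤-reflexive homG)
    (≤-trans (∑-mono (λ i → term (finToFun i))) (≤-reflexive (sym (hom-∑ᶠ F H))))

  hom-anti-< : ∀ f → IsHom (graph F) H f → ¬ IsHom (graph G) H (f ∘ from φ) → hom G H < hom F H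
  hom-anti-< f hf ¬hf = subst₂ _<_ (sym homG) (sym (hom-∑ᶠ F H))
    (∑-mono-< (λ i → term (finToFun i)) (funToFin f) (subst₂ _<_
      (sym (𝟙-no (isHom? (graph G) H _) (¬hf ∘ IsHom-cong (graph G) H (λ v → finToFun-funToFin f (from φ v)))))
      (sym (𝟙-yes (isHom? (graph F) H _) (IsHom-cong (graph F) H (sym ∘ finToFun-funToFin f) hf)))
      (s≤s z≤n)))

++-isHom : (F : SimpleGraph k) (G : SimpleGraph l) (H : Graph m) → ∀ f h →
  IsHom (graph F) H f → IsHom (graph G) H h → IsHom (graph (F ⊕ G)) H (f F.++ h)
++-isHom {k} F G H f h ef eh v w e with splitAt k v | splitAt k w
++-isHom F G H f h ef eh v w (inj₁ e) | inj₁ x | inj₁ y = ef x y e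
++-isHom F G H f h ef eh v w (inj₂ e) | inj₂ x | inj₂ y = eh x y e

hom-⊕ : ∀ {m} (F : SimpleGraph k) (G : SimpleGraph l) (H : Graph m) → hom (F ⊕ G) H ≡ hom F H * hom G H
hom-⊕ {k} {l} {m} F G H = begin
  hom (F ⊕ G) H
    ≡⟨ hom-∑ᶠ (F ⊕ G) H ⟩
  ∑ᶠ (k + l) (𝟙-hom (F ⊕ G) H)
    ≡⟨ ∑ᶠ-++ k l (𝟙-hom (F ⊕ G) H) (𝟙-hom-ext (F ⊕ G) H) ⟩
  ∑ᶠ k (λ f → ∑ᶠ l (λ h → 𝟙-hom (F ⊕ G) H (f F.++ h)))
    ≡⟨ ∑ᶠ-cong k (λ f → ∑ᶠ-cong l (λ h →
         𝟙-× (isHom? (graph F) H f) (isHom? (graph G) H h) (isHom? (graph (F ⊕ G)) H _) (split f h) (++-isHom F G H f h))) ⟩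
  ∑ᶠ k (λ f → ∑ᶠ l (λ h → 𝟙-hom F H f * 𝟙-hom G H h))
    ≡⟨ ∑ᶠ-cong k (λ f → sym (*-distribˡ-sum (𝟙-hom F H f) (λ i → 𝟙-hom G H (finToFun {m} {l} i)))) ⟩
  ∑ᶠ k (λ f → 𝟙-hom F H f * ∑ᶠ l (𝟙-hom G H))
    ≡⟨ *-distribʳ-sum (∑ᶠ l (𝟙-hom G H)) (λ i → 𝟙-hom F H (finToFun i)) ⟨
  ∑ᶠ k (𝟙-hom F H) * ∑ᶠ l (𝟙-hom G H)
    ≡⟨ cong₂ _*_ (hom-∑ᶠ F H) (hom-∑ᶠ G H) ⟨
  hom F H * hom G H ∎
  where
  open ≡-Reasoning
  split : ∀ f h → IsHom (graph (F ⊕ G)) H (f F.++ h) → IsHom (graph F) H f × IsHom (graph G) H h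
  split f h e .proj₁ v w vw = subst₂ (λ x y → Adj H ([ f , h ]′ x) ([ f , h ]′ y)) (splitAt-↑ˡ k v l) (splitAt-↑ˡ k w l)
    (e (v ↑ˡ l) (w ↑ˡ l) (subst₂ (Pointwise _ _) (sym (splitAt-↑ˡ k v l)) (sym (splitAt-↑ˡ k w l)) (inj₁ vw)))
  split f h e .proj₂ v w vw = subst₂ (λ x y → Adj H ([ f , h ]′ x) ([ f , h ]′ y)) (splitAt-↑ʳ k l v) (splitAt-↑ʳ k l w)
    (e (k ↑ʳ v) (k ↑ʳ w) (subst₂ (Pointwise _ _) (sym (splitAt-↑ʳ k l v)) (sym (splitAt-↑ʳ k l w)) (inj₂ vw)))

-- Power sums

-- Keeping the defect explicit yields the weak and the strict inequality at once.
x²+y²≡2xy+∣x-y∣² : ∀ x y → x * x + y * y ≡ 2 * (x * y) + ∣ x - y ∣ * ∣ x - y ∣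
x²+y²≡2xy+∣x-y∣² x y = [ ordered , flipped ]′ (≤-total x y)
  where
  identity : ∀ x t → x * x + (x + t) * (x + t) ≡ 2 * (x * (x + t)) + t * t
  identity = solve-∀
  ordered : ∀ {x y} → x ≤ y → x * x + y * y ≡ 2 * (x * y) + ∣ x - y ∣ * ∣ x - y ∣
  ordered {x} x≤y with t , refl ← m≤n⇒∃[o]m+o≡n x≤y rewrite ∣m-m+n∣≡n x t = identity x t
  flipped : y ≤ x → x * x + y * y ≡ 2 * (x * y) + ∣ x - y ∣ * ∣ x - y ∣
  flipped y≤x rewrite +-comm (x * x) (y * y) | *-comm x y | ∣-∣-comm x y = ordered y≤x

2xy≤x²+y² : ∀ x y → 2 * (x * y) ≤ x * x + y * y
2xy≤x²+y² x y = ≤-trans (m≤m+n _ _) (≤-reflexive (sym (x²+y²≡2xy+∣x-y∣² x y)))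

2xy<x²+y² : ∀ {x y} → x ≢ y → 2 * (x * y) < x * x + y * y
2xy<x²+y² {x} {y} x≢y = <-≤-trans (m<m+n _ (*-mono-< 0<δ 0<δ)) (≤-reflexive (sym (x²+y²≡2xy+∣x-y∣² x y)))
  where
  0<δ : 0 < ∣ x - y ∣
  0<δ = n≢0⇒n>0 (x≢y ∘ ∣m-n∣≡0⇒m≡n)

powerSum : Vector ℕ n → ℕ → ℕ
powerSum f k = sum (λ i → f i ^ k)

sum*sum : (f : Vector ℕ m) (g : Vector ℕ n) → sum f * sum g ≡ ∑[ i < m ] ∑[ j < n ] (f i * g j)
sum*sum f g = trans (*-distribʳ-sum (sum g) f) (sum-cong-≗ λ i → *-distribˡ-sum (f i) g)

module _ (f : Vector ℕ n) (k : ℕ) where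

  private
    -- The doubled sides of Cauchy-Schwarz as double sums. Symmetrising the right side in i and j
    -- gives both entries the common factor `f i ^ k * f j ^ k`, and what remains is 2xy ≤ x² + y².
    lower upper : Fin n → Fin n → ℕ
    lower i j = 2 * (f i ^ suc k * f j ^ suc k)
    upper i j = f i ^ k * f j ^ suc (suc k) + f i ^ suc (suc k) * f j ^ k

    lower-factor : ∀ i j → lower i j ≡ f i ^ k * f j ^ k * (2 * (f i * f j))
    lower-factor i j = identity (f i) (f j) (f i ^ k) (f j ^ k)
      where
      identity : ∀ x y p q → 2 * ((x * p) * (y * q)) ≡ p * q * (2 * (x * y))
      identity = solve-∀

    upper-factor : ∀ i j → f i ^ k * f j ^ k * (f i * f i + f j * f j) ≡ upper i j
    upper-factor i j = identity (f i) (f j) (f i ^ k) (f j ^ k)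
      where
      identity : ∀ x y p q → p * q * (x * x + y * y) ≡ p * (y * (y * q)) + (x * (x * p)) * q
      identity = solve-∀

    ∑lower : ∑[ i < n ] ∑[ j < n ] lower i j ≡ 2 * powerSum f (suc k) ^ 2
    ∑lower = begin
      ∑[ i < n ] ∑[ j < n ] lower i j
        ≡⟨ sum-cong-≗ (λ i → sym (*-distribˡ-sum 2 (λ j → f i ^ suc k * f j ^ suc k))) ⟩
      ∑[ i < n ] (2 * ∑[ j < n ] (f i ^ suc k * f j ^ suc k))
        ≡⟨ *-distribˡ-sum 2 (λ i → ∑[ j < n ] (f i ^ suc k * f j ^ suc k)) ⟨
      2 * ∑[ i < n ] ∑[ j < n ] (f i ^ suc k * f j ^ suc k)
        ≡⟨ cong (2 *_) (sum*sum (λ i → f i ^ suc k) (λ j → f j ^ suc k)) ⟨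
      2 * (powerSum f (suc k) * powerSum f (suc k))
        ≡⟨ cong (λ x → 2 * (powerSum f (suc k) * x)) (*-identityʳ _) ⟨
      2 * powerSum f (suc k) ^ 2 ∎
      where open ≡-Reasoning

    ∑upper : ∑[ i < n ] ∑[ j < n ] upper i j ≡ 2 * (powerSum f k * powerSum f (suc (suc k)))
    ∑upper = begin
      ∑[ i < n ] ∑[ j < n ] upper i j
        ≡⟨ sum-cong-≗ (λ i → ∑-distrib-+ (λ j → f i ^ k * f j ^ suc (suc k)) (λ j → f i ^ suc (suc k) * f j ^ k)) ⟩
      ∑[ i < n ] (∑[ j < n ] (f i ^ k * f j ^ suc (suc k)) + ∑[ j < n ] (f i ^ suc (suc k) * f j ^ k))
        ≡⟨ ∑-distrib-+ (λ i → ∑[ j < n ] (f i ^ k * f j ^ suc (suc k))) (λ i → ∑[ j < n ] (f i ^ suc (suc k) * f j ^ k)) ⟩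
      ∑[ i < n ] ∑[ j < n ] (f i ^ k * f j ^ suc (suc k)) + ∑[ i < n ] ∑[ j < n ] (f i ^ suc (suc k) * f j ^ k)
        ≡⟨ cong₂ _+_ (sum*sum (λ i → f i ^ k) (λ i → f i ^ suc (suc k))) (sum*sum (λ i → f i ^ suc (suc k)) (λ i → f i ^ k)) ⟨
      powerSum f k * powerSum f (suc (suc k)) + powerSum f (suc (suc k)) * powerSum f k
        ≡⟨ double (powerSum f k) (powerSum f (suc (suc k))) ⟩
      2 * (powerSum f k * powerSum f (suc (suc k))) ∎
      where
      open ≡-Reasoning
      double : ∀ x y → x * y + y * x ≡ 2 * (x * y)
      double = solve-∀

    lower≤upper : ∀ i j → lower i j ≤ upper i j
    lower≤upper i j = subst₂ _≤_ (sym (lower-factor i j)) (upper-factor i j)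
      (*-monoʳ-≤ (f i ^ k * f j ^ k) (2xy≤x²+y² (f i) (f j)))

    lower<upper : (∀ i → 0 < f i) → ∀ i j → f i ≢ f j → lower i j < upper i j
    lower<upper f>0 i j fi≢fj = subst₂ _<_ (sym (lower-factor i j)) (upper-factor i j)
      (*-monoʳ-< (f i ^ k * f j ^ k)
        {{m*n≢0 _ _ {{m^n≢0 (f i) k {{>-nonZero (f>0 i)}}}} {{m^n≢0 (f j) k {{>-nonZero (f>0 j)}}}}}} (2xy<x²+y² fi≢fj))

  powerSum-logConvex : powerSum f (suc k) ^ 2 ≤ powerSum f k * powerSum f (suc (suc k))
  powerSum-logConvex = *-cancelˡ-≤ 2 (subst₂ _≤_ ∑lower ∑upper (∑-mono λ i → ∑-mono (lower≤upper i)))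

  -- One pair of distinct values makes one entry strict; positivity keeps its common factor from
  -- vanishing.
  powerSum-logConvex-< : (∀ i → 0 < f i) → ∀ i j → f i ≢ f j →
    powerSum f (suc k) ^ 2 < powerSum f k * powerSum f (suc (suc k))
  powerSum-logConvex-< f>0 i j fi≢fj = *-cancelˡ-< 2 _ _ (subst₂ _<_ ∑lower ∑upper
    (∑-mono-< (λ i → ∑-mono (lower≤upper i)) i (∑-mono-< (lower≤upper i) j (lower<upper f>0 i j fi≢fj))))

-- Unimodality of log-convex sequences

^-cancelʳ-≤ : ∀ n x y → x ^ suc n ≤ y ^ suc n → x ≤ y
^-cancelʳ-≤ n x y p = ≮⇒≥ λ y<x → <⇒≱ (^-monoˡ-< (suc n) y<x) p

^-distribʳ-* : ∀ n x y → (x * y) ^ n ≡ x ^ n * y ^ n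
^-distribʳ-* zero    x y = refl
^-distribʳ-* (suc n) x y = trans (cong (x * y *_) (^-distribʳ-* n x y)) ([m*n]*[o*p]≡[m*o]*[n*p] x y (x ^ n) (y ^ n))

^-^-comm : ∀ x a b → (x ^ a) ^ b ≡ (x ^ b) ^ a
^-^-comm x a b = trans (^-*-assoc x a b) (trans (cong (x ^_) (*-comm a b)) (sym (^-*-assoc x b a)))

module Roots (u : ℕ → ℕ) where

  -- j ⊑ k says u j ^ (1 / (j + 1)) ≤ u k ^ (1 / (k + 1)), with the roots cleared.
  infix 4 _⊑_ _⊏_

  _⊑_ _⊏_ : ℕ → ℕ → Set
  j ⊑ k = u j ^ suc k ≤ u k ^ suc j
  j ⊏ k = u j ^ suc k < u k ^ suc j

  ⊑-refl : ∀ {k} → k ⊑ k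
  ⊑-refl = ≤-refl

  -- Raised to the powers l + 1 and j + 1, the two hypotheses meet in a power of `u k`; the exponent
  -- k + 1 is cancelled at the end.
  ⊑-trans : ∀ {j k l} → j ⊑ k → k ⊑ l → j ⊑ l
  ⊑-trans {j} {k} {l} p q = ^-cancelʳ-≤ k _ _ (begin
    (u j ^ suc l) ^ suc k ≡⟨ ^-^-comm (u j) (suc l) (suc k) ⟩
    (u j ^ suc k) ^ suc l ≤⟨ ^-monoˡ-≤ (suc l) p ⟩
    (u k ^ suc j) ^ suc l ≡⟨ ^-^-comm (u k) (suc j) (suc l) ⟩
    (u k ^ suc l) ^ suc j ≤⟨ ^-monoˡ-≤ (suc j) q ⟩
    (u l ^ suc k) ^ suc j ≡⟨ ^-^-comm (u l) (suc k) (suc j) ⟩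
    (u l ^ suc j) ^ suc k ∎)
    where open ≤-Reasoning

  -- The order is total, so `⊏` is the negation of the reversed `⊑` and strict transitivity reduces
  -- to the weak one.
  ⊏-⊑-trans : ∀ {j k l} → j ⊏ k → k ⊑ l → j ⊏ l
  ⊏-⊑-trans {j} {k} {l} p q = ≰⇒> λ l⊑j → <⇒≱ p (⊑-trans {k} {l} {j} q l⊑j)

  ⊑-⊏-trans : ∀ {j k l} → j ⊑ k → k ⊏ l → j ⊏ l
  ⊑-⊏-trans {j} {k} {l} p q = ≰⇒> λ l⊑j → <⇒≱ q (⊑-trans {l} {j} {k} l⊑j p)

  module LogConvex (u>0 : ∀ k → 0 < u k)
                   (convex : ∀ k → u (suc k) ^ 2 ≤ u k * u (suc (suc k))) where

    private
      module Step (k : ℕ) where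
        instance
          uᵏ≢0 : NonZero (u (suc k) ^ suc k)
          uᵏ≢0 = m^n≢0 (u (suc k)) (suc k) {{>-nonZero (u>0 (suc k))}}

        split : (u (suc k) ^ 2) ^ suc (suc k) ≡ u (suc k) ^ suc k * u (suc k) ^ suc (suc (suc k))
        split = trans (^-*-assoc (u (suc k)) 2 (suc (suc k))) (trans (cong (u (suc k) ^_) (exponents k)) (^-distribˡ-+-* (u (suc k)) (suc k) _))
          where
          exponents : ∀ k → 2 * suc (suc k) ≡ suc k + suc (suc (suc k))
          exponents = solve-∀

        distrib : (u k * u (suc (suc k))) ^ suc (suc k) ≡ u k ^ suc (suc k) * u (suc (suc k)) ^ suc (suc k)
        distrib = ^-distribʳ-* (suc (suc k)) (u k) (u (suc (suc k)))

    -- Once the slope rises, it keeps rising. Convexity is raised to the power k + 2, and the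
    -- exponent 2 (k + 2) on the left is split as (k + 1) + (k + 3); the hypothesis turns
    -- `u k ^ (k + 2)` into the first of these two factors, which then cancels.
    step-< : ∀ k → k ⊏ suc k → suc k ⊏ suc (suc k)
    step-< k p = *-cancelˡ-< (u (suc k) ^ suc k) _ _ (begin-strict
      u (suc k) ^ suc k * u (suc k) ^ suc (suc (suc k))     ≡⟨ split ⟨
      (u (suc k) ^ 2) ^ suc (suc k)                         ≤⟨ ^-monoˡ-≤ (suc (suc k)) (convex k) ⟩
      (u k * u (suc (suc k))) ^ suc (suc k)                 ≡⟨ distrib ⟩
      u k ^ suc (suc k) * u (suc (suc k)) ^ suc (suc k)     <⟨ *-monoˡ-< _ {{m^n≢0 _ (suc (suc k)) {{>-nonZero (u>0 (suc (suc k)))}}}} p ⟩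
      u (suc k) ^ suc k * u (suc (suc k)) ^ suc (suc k)     ∎)
      where
      open ≤-Reasoning
      open Step k

    -- The same cancellation, with the strictness taken from convexity: even a level step is
    -- followed by a rise.
    strictStep : ∀ k → u (suc k) ^ 2 < u k * u (suc (suc k)) → k ⊑ suc k → suc k ⊏ suc (suc k)
    strictStep k convex< p = *-cancelˡ-< (u (suc k) ^ suc k) _ _ (begin-strict
      u (suc k) ^ suc k * u (suc k) ^ suc (suc (suc k))     ≡⟨ split ⟨
      (u (suc k) ^ 2) ^ suc (suc k)                         <⟨ ^-monoˡ-< (suc (suc k)) convex< ⟩
      (u k * u (suc (suc k))) ^ suc (suc k)                 ≡⟨ distrib ⟩
      u k ^ suc (suc k) * u (suc (suc k)) ^ suc (suc k)     ≤⟨ *-monoˡ-≤ _ p ⟩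
      u (suc k) ^ suc k * u (suc (suc k)) ^ suc (suc k)     ∎)
      where
      open ≤-Reasoning
      open Step k

    -- The second component is the invariant that carries the induction.
    ascent : ∀ k l → k ≤′ l → k ⊏ suc k → k ⊑ l × l ⊏ suc l
    ascent k .k      ≤′-refl           p = ⊑-refl , p
    ascent k (suc l) (≤′-step k≤l) p with q , r ← ascent k l k≤l p =
      ⊑-trans {k} {l} {suc l} q (<⇒≤ r) , step-< l r

    ascent-< : ∀ {k l} → k < l → k ⊏ suc k → k ⊏ l
    ascent-< {k} {l} k<l p = ⊏-⊑-trans {k} {suc k} {l} p (proj₁ (ascent (suc k) l (≤⇒≤′ k<l) (step-< k p)))

    -- Contrapositive of `step-<`: a step that does not rise is preceded only by steps that do not
    -- rise, all the way down to 1.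
    descent : ∀ k → suc (suc k) ⊑ suc k → suc k ⊑ 1
    descent zero    p = ⊑-refl
    descent (suc k) p = ⊑-trans {suc (suc k)} {suc k} {1} q (descent k q)
      where
      q : suc (suc k) ⊑ suc k
      q = ≮⇒≥ λ r → <⇒≱ (step-< (suc k) r) p

    endpoint-max : ∀ k D → suc k ≤ D → suc k ⊑ 1 ⊎ suc k ⊑ D
    endpoint-max k D k≤D with u (suc k) ^ suc (suc (suc k)) <? u (suc (suc k)) ^ suc (suc k)
    ... | yes p = inj₂ (proj₁ (ascent (suc k) D (≤⇒≤′ k≤D) p))
    ... | no ¬p = inj₁ (descent k (≮⇒≥ ¬p))

    -- Put t = k + 2. If the step after t rises, then t lies strictly below t + 1, hence below 1.
    -- Otherwise strict convexity forbids the step before t to be level or rising, so t lies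
    -- strictly below t - 1, which is on the descending branch.
    strictly-below-edge : ∀ k → u (suc (suc k)) ^ 2 < u (suc k) * u (suc (suc (suc k))) →
      suc (suc (suc k)) ⊑ 1 → suc (suc k) ⊏ 1
    strictly-below-edge k convex< p with u (suc (suc k)) ^ suc (suc (suc (suc k))) <? u (suc (suc (suc k))) ^ suc (suc (suc k))
    ... | yes q = ⊏-⊑-trans {suc (suc k)} {suc (suc (suc k))} {1} q p
    ... | no ¬q = ⊏-⊑-trans {suc (suc k)} {suc k} {1} r (descent k (<⇒≤ r))
      where
      r : suc (suc k) ⊏ suc k
      r = ≰⇒> λ s → ¬q (strictStep (suc k) convex< s)

    -- Here `N` stands for n₀ - 3: the star with n₀ vertices beats the edge and the star with n₀ - 1
    -- vertices does not. The step between them therefore rises, and so do all later ones.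
    module _ (N : ℕ) (1⊏N : 1 ⊏ suc (suc N)) (minimal : suc N ⊑ 1) where

      private
        N⊏sucN : suc N ⊏ suc (suc N)
        N⊏sucN = ⊑-⊏-trans {suc N} {1} {suc (suc N)} minimal 1⊏N

      edge-below : ∀ D → suc (suc N) ≤ D → 1 ⊏ D
      edge-below D N≤D = ⊏-⊑-trans {1} {suc (suc N)} {D} 1⊏N
        (proj₁ (ascent (suc (suc N)) D (≤⇒≤′ N≤D) (step-< (suc N) N⊏sucN)))

      -- A size on the rising branch is exceeded by every later one; a size on the falling branch is
      -- at most the edge, which `D` beats.
      strictly-below-star : ∀ D → suc (suc N) ≤ D → ∀ k → suc k < D → suc k ⊏ D
      strictly-below-star D N≤D k k<D with u (suc k) ^ suc (suc (suc k)) <? u (suc (suc k)) ^ suc (suc k)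
      ... | yes p = ascent-< k<D p
      ... | no ¬p = ⊑-⊏-trans {suc k} {1} {D} (descent k (≮⇒≥ ¬p)) (edge-below D N≤D)

-- Stars

isHom-star⁻ : (H : Graph m) (f : Fin (1 + k) → Fin m) →
  IsHom (graph K[ 1 , k ]) H f → ∀ i → Adj H (f zero) (f (suc i))
isHom-star⁻ H f h i = h zero (suc i) λ ()

isHom-star⁺ : (H : Graph m) (f : Fin (1 + k) → Fin m) →
  (∀ i → Adj H (f zero) (f (suc i))) → IsHom (graph K[ 1 , k ]) H f
isHom-star⁺ H f h zero    zero    e = contradiction refl e
isHom-star⁺ H f h zero    (suc j) e = h j
isHom-star⁺ H f h (suc i) zero    e = adj-sym H (h i)
isHom-star⁺ H f h (suc i) (suc j) e = contradiction refl e

-- With the centre of a star placed at `x`, the leaves are chosen independently among the neighbours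
-- of `x`.
∑ᶠ-neighbours : ∀ (H : Graph m) x k →
  ∑ᶠ k (λ f → 𝟙 (all? λ i → adj? H x (f i))) ≡ degree H x ^ k
∑ᶠ-neighbours {m} H x zero    = cong (_+ 0) (𝟙-yes (all? {n = 0} λ i → adj? H x (finToFun {m} {0} zero i)) λ ())
∑ᶠ-neighbours {m} H x (suc k) = begin
  ∑ᶠ (suc k) nbrs
    ≡⟨ ∑ᶠ-suc k nbrs (λ {f} {g} p → 𝟙-cong (nbrs? f) (nbrs? g)
         (λ q i → subst (Adj H x) (p i) (q i)) (λ q i → subst (Adj H x) (sym (p i)) (q i))) ⟩
  ∑[ y < m ] ∑ᶠ k (λ f → nbrs (y F.∷ f))
    ≡⟨ sum-cong-≗ (λ y → ∑ᶠ-cong k λ f → 𝟙-× (adj? H x y) (nbrs? f) (nbrs? (y F.∷ f))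
         (λ q → q zero , q ∘ suc) (cons y f)) ⟩
  ∑[ y < m ] ∑ᶠ k (λ f → 𝟙 (adj? H x y) * nbrs f)
    ≡⟨ sum-cong-≗ (λ y → sym (*-distribˡ-sum (𝟙 (adj? H x y)) (λ i → nbrs (finToFun {m} {k} i)))) ⟩
  ∑[ y < m ] (𝟙 (adj? H x y) * ∑ᶠ k nbrs)
    ≡⟨ *-distribʳ-sum (∑ᶠ k nbrs) (λ y → 𝟙 (adj? H x y)) ⟨
  ∑[ y < m ] 𝟙 (adj? H x y) * ∑ᶠ k nbrs
    ≡⟨ cong₂ _*_ (sym (degree-∑ H x)) (∑ᶠ-neighbours H x k) ⟩
  degree H x ^ suc k ∎
  where
  open ≡-Reasoning
  nbrs? : ∀ {k} (f : Fin k → Fin m) → Dec (∀ i → Adj H x (f i))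
  nbrs? f = all? λ i → adj? H x (f i)
  cons : ∀ {k} y (f : Fin k → Fin m) → Adj H x y → (∀ i → Adj H x (f i)) → ∀ i → Adj H x ((y F.∷ f) i)
  cons y f e es zero    = e
  cons y f e es (suc i) = es i
  nbrs : ∀ {k} → (Fin k → Fin m) → ℕ
  nbrs f = 𝟙 (nbrs? f)

hom-star-powerSum : ∀ k (H : Graph m) → hom K[ 1 , k ] H ≡ powerSum (degree H) k
hom-star-powerSum {m} k H = begin
  hom K[ 1 , k ] H
    ≡⟨ hom-∑ᶠ K[ 1 , k ] H ⟩
  ∑ᶠ (suc k) (𝟙-hom K[ 1 , k ] H)
    ≡⟨ ∑ᶠ-suc k (𝟙-hom K[ 1 , k ] H) (𝟙-hom-ext K[ 1 , k ] H) ⟩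
  ∑[ x < m ] ∑ᶠ k (λ f → 𝟙-hom K[ 1 , k ] H (x F.∷ f))
    ≡⟨ sum-cong-≗ (λ x → ∑ᶠ-cong k λ f → 𝟙-cong (isHom? (graph K[ 1 , k ]) H (x F.∷ f)) (all? λ i → adj? H x (f i))
         (isHom-star⁻ H (x F.∷ f)) (isHom-star⁺ H (x F.∷ f))) ⟩
  ∑[ x < m ] ∑ᶠ k (λ f → 𝟙 (all? λ i → adj? H x (f i)))
    ≡⟨ sum-cong-≗ (λ x → ∑ᶠ-neighbours H x k) ⟩
  powerSum (degree H) k ∎
  where open ≡-Reasoning

-- Opaque because the type checker would otherwise unfold the enumeration of all maps.
opaque

  starHom : Graph m → ℕ → ℕ
  starHom H k = hom K[ 1 , k ] H

  hom-star : ∀ k (H : Graph m) → hom K[ 1 , k ] H ≡ starHom H k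
  hom-star k H = refl

  starHom-powerSum : ∀ (H : Graph m) k → starHom H k ≡ powerSum (degree H) k
  starHom-powerSum H k = hom-star-powerSum k H

-- Isomorphisms

-- Arbitrary carriers let a disjoint union live on a sum type, where commutativity and associativity
-- involve no index arithmetic.
record RelIso {A B : Set} (R : Rel A 0ℓ) (S : Rel B 0ℓ) : Set where
  constructor mkRelIso
  field
    bijection : A ↔ B
    related   : ∀ v w → R v w ⇔ S (to bijection v) (to bijection w)

open RelIso

module _ {A B C : Set} {R : Rel A 0ℓ} {S : Rel B 0ℓ} {T : Rel C 0ℓ} where

  relIso-trans : RelIso R S → RelIso S T → RelIso R T
  relIso-trans (mkRelIso φ e) (mkRelIso ψ e′) = mkRelIso (↔-trans φ ψ) λ v w → mk⇔
    (Equivalence.to (e′ _ _) ∘ Equivalence.to (e v w))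
    (Equivalence.from (e v w) ∘ Equivalence.from (e′ _ _))

relIso-refl : {A : Set} {R : Rel A 0ℓ} → RelIso R R
relIso-refl = mkRelIso ↔-refl λ _ _ → mk⇔ id id

module _ {A B : Set} {R : Rel A 0ℓ} {S : Rel B 0ℓ} where

  relIso-sym : RelIso R S → RelIso S R
  relIso-sym (mkRelIso φ e) = mkRelIso (↔-sym φ) λ v w → mk⇔
    (λ s → Equivalence.from (e _ _) (subst₂ S (sym (strictlyInverseˡ φ v)) (sym (strictlyInverseˡ φ w)) s))
    (λ r → subst₂ S (strictlyInverseˡ φ v) (strictlyInverseˡ φ w) (Equivalence.to (e _ _) r))

module _ {A B C D : Set} {R : Rel A 0ℓ} {R′ : Rel B 0ℓ} {S : Rel C 0ℓ} {S′ : Rel D 0ℓ} where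

  ⊎-relIso : RelIso R R′ → RelIso S S′ → RelIso (Pointwise R S) (Pointwise R′ S′)
  ⊎-relIso (mkRelIso φ e) (mkRelIso ψ e′) = mkRelIso (φ ⊎-↔ ψ) λ where
    (inj₁ x) (inj₁ y) → mk⇔
      (λ where (inj₁ r) → inj₁ (Equivalence.to (e x y) r))
      (λ where (inj₁ r) → inj₁ (Equivalence.from (e x y) r))
    (inj₂ x) (inj₂ y) → mk⇔
      (λ where (inj₂ r) → inj₂ (Equivalence.to (e′ x y) r))
      (λ where (inj₂ r) → inj₂ (Equivalence.from (e′ x y) r))
    (inj₁ x) (inj₂ y) → mk⇔ (λ ()) (λ ())
    (inj₂ x) (inj₁ y) → mk⇔ (λ ()) (λ ())

module _ {A B : Set} {R : Rel A 0ℓ} {S : Rel B 0ℓ} where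

  ⊎-relIso-comm : RelIso (Pointwise R S) (Pointwise S R)
  ⊎-relIso-comm = mkRelIso (⊎-comm A B) λ where
    (inj₁ _) (inj₁ _) → mk⇔ (λ where (inj₁ r) → inj₂ r) (λ where (inj₂ r) → inj₁ r)
    (inj₁ _) (inj₂ _) → mk⇔ (λ ()) (λ ())
    (inj₂ _) (inj₁ _) → mk⇔ (λ ()) (λ ())
    (inj₂ _) (inj₂ _) → mk⇔ (λ where (inj₂ r) → inj₁ r) (λ where (inj₁ r) → inj₂ r)

module _ {A B C : Set} {R : Rel A 0ℓ} {S : Rel B 0ℓ} {T : Rel C 0ℓ} where

  ⊎-relIso-assoc : RelIso (Pointwise (Pointwise R S) T) (Pointwise R (Pointwise S T))
  ⊎-relIso-assoc = mkRelIso (⊎-assoc 0ℓ A B C) λ where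
    (inj₁ (inj₁ _)) (inj₁ (inj₁ _)) → mk⇔ (λ where (inj₁ (inj₁ r)) → inj₁ r) (λ where (inj₁ r) → inj₁ (inj₁ r))
    (inj₁ (inj₁ _)) (inj₁ (inj₂ _)) → mk⇔ (λ where (inj₁ ())) (λ ())
    (inj₁ (inj₁ _)) (inj₂ _)        → mk⇔ (λ ()) (λ ())
    (inj₁ (inj₂ _)) (inj₁ (inj₁ _)) → mk⇔ (λ where (inj₁ ())) (λ ())
    (inj₁ (inj₂ _)) (inj₁ (inj₂ _)) → mk⇔ (λ where (inj₁ (inj₂ r)) → inj₂ (inj₁ r)) (λ where (inj₂ (inj₁ r)) → inj₁ (inj₂ r))
    (inj₁ (inj₂ _)) (inj₂ _)        → mk⇔ (λ ()) (λ where (inj₂ ()))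
    (inj₂ _)        (inj₁ (inj₁ _)) → mk⇔ (λ ()) (λ ())
    (inj₂ _)        (inj₁ (inj₂ _)) → mk⇔ (λ ()) (λ where (inj₂ ()))
    (inj₂ _)        (inj₂ _)        → mk⇔ (λ where (inj₂ r) → inj₂ (inj₂ r)) (λ where (inj₂ (inj₂ r)) → inj₂ r)

infix 4 _≃_

-- A record, so that the two graphs can be inferred from a proof.
record _≃_ (F : SimpleGraph k) (G : SimpleGraph l) : Set where
  constructor mk≃
  field
    relIso : RelIso (Adj (graph F)) (Adj (graph G))

open _≃_

≅⇒≃ : {F : SimpleGraph k} {G : SimpleGraph l} → graph F ≅ graph G → F ≃ G
≅⇒≃ (φ , e) = mk≃ (mkRelIso φ e)

≃⇒≅ : {F : SimpleGraph k} {G : SimpleGraph l} → F ≃ G → graph F ≅ graph G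
≃⇒≅ (mk≃ (mkRelIso φ e)) = φ , e

≃-refl : {F : SimpleGraph k} → F ≃ F
≃-refl = mk≃ relIso-refl

≃-sym : {F : SimpleGraph k} {G : SimpleGraph l} → F ≃ G → G ≃ F
≃-sym i = mk≃ (relIso-sym (relIso i))

≃-trans : {F : SimpleGraph k} {G : SimpleGraph l} {E : SimpleGraph m} → F ≃ G → G ≃ E → F ≃ E
≃-trans i j = mk≃ (relIso-trans (relIso i) (relIso j))

hom-≃ : {F : SimpleGraph k} {G : SimpleGraph l} (H : Graph m) → F ≃ G → hom F H ≡ hom G H
hom-≃ {F = F} {G} H i = ≤-antisym
  (hom-anti G F H (bijection (relIso (≃-sym i))) λ v w → Equivalence.to (related (relIso (≃-sym i)) v w))
  (hom-anti F G H (bijection (relIso i)) λ v w → Equivalence.to (related (relIso i) v w))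

⊕-relIso : (F : SimpleGraph k) (G : SimpleGraph l) →
  RelIso (Adj (graph (F ⊕ G))) (Pointwise (Adj (graph F)) (Adj (graph G)))
⊕-relIso F G = mkRelIso +↔⊎ λ _ _ → mk⇔ id id

⊕-cong : {F : SimpleGraph a} {F′ : SimpleGraph b} {G : SimpleGraph c} {G′ : SimpleGraph d} →
  F ≃ F′ → G ≃ G′ → F ⊕ G ≃ F′ ⊕ G′
⊕-cong {F = F} {F′} {G} {G′} i j = mk≃ (relIso-trans (⊕-relIso F G)
  (relIso-trans (⊎-relIso (relIso i) (relIso j)) (relIso-sym (⊕-relIso F′ G′))))

⊕-comm : (F : SimpleGraph a) (G : SimpleGraph b) → F ⊕ G ≃ G ⊕ F
⊕-comm F G = mk≃ (relIso-trans (⊕-relIso F G)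
  (relIso-trans ⊎-relIso-comm (relIso-sym (⊕-relIso G F))))

⊕-assoc : (F : SimpleGraph a) (G : SimpleGraph b) (E : SimpleGraph c) → (F ⊕ G) ⊕ E ≃ F ⊕ G ⊕ E
⊕-assoc F G E = mk≃ (relIso-trans
  (relIso-trans (⊕-relIso (F ⊕ G) E) (⊎-relIso (⊕-relIso F G) relIso-refl))
  (relIso-trans ⊎-relIso-assoc
    (relIso-sym (relIso-trans (⊕-relIso F (G ⊕ E)) (⊎-relIso relIso-refl (⊕-relIso G E))))))

⊕-swap : (F : SimpleGraph a) (G : SimpleGraph b) (E : SimpleGraph c) → F ⊕ G ⊕ E ≃ G ⊕ F ⊕ E
⊕-swap F G E = ≃-trans (≃-sym (⊕-assoc F G E)) (≃-trans (⊕-cong (⊕-comm F G) (≃-refl {F = E})) (⊕-assoc G F E))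

K₂≃star : K 2 ≃ K[ 1 , 1 ]
K₂≃star = mk≃ (mkRelIso ↔-refl λ where
  zero       zero       → mk⇔ (λ e → contradiction refl e) (λ e → contradiction refl e)
  zero       (suc zero) → mk⇔ (λ _ ()) (λ _ ())
  (suc zero) zero       → mk⇔ (λ _ ()) (λ _ ())
  (suc zero) (suc zero) → mk⇔ (λ e → contradiction refl e) (λ e → contradiction refl e))

hom-K₂ : (H : Graph m) → hom (K 2) H ≡ starHom H 1
hom-K₂ H = trans (hom-≃ H K₂≃star) (hom-star 1 H)

-- Star forests

size : List ℕ → ℕ
size []       = 0
size (k ∷ ks) = 1 + k + size ks

forest : ∀ ks → SimpleGraph (size ks)
forest []       = K 0
forest (k ∷ ks) = K[ 1 , k ] ⊕ forest ks

-- The index lists the covered vertices star by star, each centre before its leaves. The first leaf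
-- `v` is kept apart from `ls` so that no star is a single vertex. Disjointness comes later, from
-- the list being a permutation of `allFin n`.
data StarCover (G : Graph n) : List (Fin n) → Set where
  []   : StarCover G []
  star : ∀ {v} c ls → All (Adj G c) (v ∷ ls) → ∀ {vs} → StarCover G vs → StarCover G (c ∷ (v ∷ ls) ++ vs)

module _ (G : SimpleGraph n) where

  private
    _~_ = Adj (graph G)

  -- If `w` is a centre, `u` becomes a new leaf. If `w` is the only leaf of its star, the star is
  -- recentred at `w` with the leaves `c` and `u`. If the star has further leaves, `w` leaves it and
  -- forms a new star with `u`.
  insert : ∀ {vs u w} → StarCover (graph G) vs → w ∈ vs → w ~ u → ∃ λ vs′ → StarCover (graph G) vs′ × vs′ ↭ u ∷ vs
  insert {u = u} (star {l} c ls adj C) (here refl) e = _ , star c (l ∷ ls) (e ∷ adj) C , swap c u ↭-refl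
  insert {u = u} {w} (star {l} c ls adj {vs} C) (there w∈) e with ∈-++⁻ (l ∷ ls) w∈
  ... | inj₂ w∈vs with vs′ , C′ , p ← insert C w∈vs e = _ , star c ls adj C′ , (begin
    c ∷ (l ∷ ls) ++ vs′     ↭⟨ ++⁺ˡ (c ∷ l ∷ ls) p ⟩
    c ∷ (l ∷ ls) ++ u ∷ vs  ↭⟨ shift u (c ∷ l ∷ ls) vs ⟩
    u ∷ c ∷ (l ∷ ls) ++ vs  ∎)
    where open PermutationReasoning
  ... | inj₁ w∈ls with xs , ys , eq ← ∈-∃++ w∈ls = rehang (xs ++ ys) (↭-trans (↭-reflexive eq) (shift w xs ys))
    where
    open PermutationReasoning
    rehang : ∀ rest → l ∷ ls ↭ w ∷ rest → ∃ λ vs′ → StarCover (graph G) vs′ × vs′ ↭ u ∷ c ∷ (l ∷ ls) ++ vs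
    rehang rest p with All-resp-↭ p adj
    rehang [] p | c~w ∷ [] = _ , star w (u ∷ []) (adj-sym (graph G) c~w ∷ e ∷ []) C , (begin
      w ∷ c ∷ u ∷ vs           ↭⟨ shift u (w ∷ c ∷ []) vs ⟩
      u ∷ w ∷ c ∷ vs           ↭⟨ prep u (swap w c ↭-refl) ⟩
      u ∷ c ∷ w ∷ vs           ↭⟨ prep u (prep c (++⁺ʳ vs (↭-sym p))) ⟩
      u ∷ c ∷ (l ∷ ls) ++ vs   ∎)
    rehang (r ∷ rs) p | c~w ∷ adj′ = _ , star c rs adj′ (star w [] (e ∷ []) C) , (begin
      c ∷ (r ∷ rs) ++ w ∷ u ∷ vs   ↭⟨ prep c (shift w (r ∷ rs) (u ∷ vs)) ⟩
      c ∷ w ∷ (r ∷ rs) ++ u ∷ vs   ↭⟨ shift u (c ∷ w ∷ r ∷ rs) vs ⟩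
      u ∷ c ∷ w ∷ (r ∷ rs) ++ vs   ↭⟨ prep u (prep c (++⁺ʳ vs (↭-sym p))) ⟩
      u ∷ c ∷ (l ∷ ls) ++ vs       ∎)

  module _ (neighbour : ∀ v → ∃ λ w → v ~ w) where

    -- `N` bounds the number of uncovered vertices for termination: each round covers either `u`
    -- alone or `u` together with an uncovered neighbour.
    extend : ∀ N {vs} us → length us ≤ N → StarCover (graph G) vs → vs ++ us ↭ allFin n →
      ∃ λ vs′ → StarCover (graph G) vs′ × vs′ ↭ allFin n
    extend N {vs} [] _ C p = vs , C , ↭-trans (↭-reflexive (sym (++-identityʳ vs))) p
    extend (suc N) {vs} (u ∷ us) (s≤s us≤N) C p with w , u~w ← neighbour u
      with ∈-++⁻ vs (∈-resp-↭ (↭-sym p) (∈-allFin w))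
    ... | inj₁ w∈vs with vs′ , C′ , q ← insert C w∈vs (adj-sym (graph G) u~w) =
      extend N us us≤N C′ (↭-trans (++⁺ʳ us q) (↭-trans (↭-sym (shift u vs us)) p))
    ... | inj₂ (here refl) = contradiction u~w (loopless G u)
    ... | inj₂ (there w∈us) with xs , ys , refl ← ∈-∃++ w∈us =
      extend N (xs ++ ys) shorter (star u [] (u~w ∷ []) C) (begin
        u ∷ w ∷ vs ++ xs ++ ys        ↭⟨ prep u (shift w vs (xs ++ ys)) ⟨
        u ∷ vs ++ w ∷ xs ++ ys        ↭⟨ prep u (++⁺ˡ vs (shift w xs ys)) ⟨
        u ∷ vs ++ xs ++ w ∷ ys        ↭⟨ shift u vs (xs ++ w ∷ ys) ⟨
        vs ++ u ∷ xs ++ w ∷ ys        ↭⟨ p ⟩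
        allFin n                      ∎)
      where
      open PermutationReasoning
      shorter : length (xs ++ ys) ≤ N
      shorter = ≤-trans (n≤1+n _) (≤-trans (≤-reflexive (sym (↭-length (shift w xs ys)))) us≤N)

    starCover : ∃ λ vs → StarCover (graph G) vs × vs ↭ allFin n
    starCover = extend (length (allFin n)) (allFin n) ≤-refl [] ↭-refl

-- The order of the cover, centre before leaves, is the vertex order of `forest ks`, so forest edges
-- can be read off by position.
layout : {G : Graph n} {vs : List (Fin n)} → StarCover G vs →
  ∃ λ ks → All (1 ≤_) ks × Σ (Vec (Fin n) (size ks)) λ xs → Vec.toList xs ≡ vs ×
    (∀ i j → Adj (graph (forest ks)) i j → Adj G (Vec.lookup xs i) (Vec.lookup xs j))
layout [] = [] , [] , Vec.[] , refl , λ ()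
layout {G = G} (star {v} c ls adj C) with ks , ks≥1 , xs , eq , h ← layout C =
  suc (length ls) ∷ ks , s≤s z≤n ∷ ks≥1 , ys Vec.++ xs ,
  trans (toList-++ ys xs) (cong₂ (λ s t → c ∷ v ∷ s ++ t) (toList∘fromList ls) eq) , λ i j e →
    subst₂ (Adj G) (sym (lookup-splitAt t ys xs i)) (sym (lookup-splitAt t ys xs j)) (edge (splitAt t i) (splitAt t j) e)
  where
  t = length (c ∷ v ∷ ls)
  ys = c Vec.∷ v Vec.∷ Vec.fromList ls
  leaf : ∀ {us} → All (Adj G c) us → ∀ i → Adj G c (Vec.lookup (Vec.fromList us) i)
  leaf (e ∷ _)  zero    = e
  leaf (_ ∷ es) (suc i) = leaf es i
  edge : ∀ x y → Pointwise (Adj (graph K[ 1 , suc (length ls) ])) (Adj (graph (forest ks))) x y →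
    Adj G ([ Vec.lookup ys , Vec.lookup xs ]′ x) ([ Vec.lookup ys , Vec.lookup xs ]′ y)
  edge (inj₁ x) (inj₁ y) (inj₁ e) = isHom-star⁺ G (Vec.lookup ys) (leaf adj) x y e
  edge (inj₂ x) (inj₂ y) (inj₂ e) = h x y e

lookup-toList : {A : Set} (xs : Vec A n) (i : Fin n) →
  Vec.lookup xs i ≡ List.lookup (Vec.toList xs) (cast (sym (length-toList xs)) i)
lookup-toList (x Vec.∷ xs) zero    = refl
lookup-toList (x Vec.∷ xs) (suc i) = lookup-toList xs i

lookup-tabulate-cast : {A : Set} (f : Fin n → A) (j : Fin (length (List.tabulate f))) →
  List.lookup (List.tabulate f) j ≡ f (cast (length-tabulate f) j)
lookup-tabulate-cast {suc n} f zero    = refl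
lookup-tabulate-cast {suc n} f (suc j) = lookup-tabulate-cast (f ∘ suc) j

-- The bijection is the one that the permutation induces on positions; position j of `allFin n`
-- holds j itself.
enumeration : (xs : Vec (Fin n) k) → Vec.toList xs ↭ allFin n →
  Σ (Fin k ↔ Fin n) λ φ → ∀ i → to φ i ≡ Vec.lookup xs i
enumeration {n} xs p =
  ↔-trans (cast-id (sym (length-toList xs))) (↔-trans (Permutation.onIndices (↭⇒↭ₛ p)) (cast-id (length-tabulate id))) ,
  λ i → sym (trans (lookup-toList xs i)
    (trans (Permutation.onIndices-lookup (setoid (Fin n)) (↭⇒↭ₛ p) _) (lookup-tabulate-cast id _)))

spanningForest : (G : SimpleGraph n) → (∀ v → ∃ λ w → Adj (graph G) v w) →
  ∃ λ ks → All (1 ≤_) ks × Σ (Fin (size ks) ↔ Fin n) (PreservesAdj (graph (forest ks)) (graph G))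
spanningForest G neighbour
  with vs , C , p ← starCover G neighbour
  with ks , ks≥1 , xs , refl , edges ← layout C
  with φ , φ≡xs ← enumeration xs p =
  ks , ks≥1 , φ , λ v w e → subst₂ (Adj (graph G)) (sym (φ≡xs v)) (sym (φ≡xs w)) (edges v w e)

-- Degrees

0<degree⇒neighbour : (G : Graph n) (v : Fin n) → 0 < degree G v → ∃ λ w → Adj G v w
0<degree⇒neighbour {n} G v 0<d with any? (adj? G v)
... | yes e = e
... | no ¬e = contradiction (begin-strict
  0                           <⟨ 0<d ⟩
  degree G v                  ≡⟨ degree-∑ G v ⟩
  ∑[ w < n ] 𝟙 (adj? G v w)   ≡⟨ sum-cong-≗ (λ w → 𝟙-no (adj? G v w) (λ e → ¬e (w , e))) ⟩
  ∑[ w < n ] 0                ≡⟨ ∑-const n 0 ⟩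
  n * 0                       ≡⟨ *-zeroʳ n ⟩
  0                           ∎) λ ()
  where open ≤-Reasoning

neighbour⇒0<degree : (G : Graph n) {v w : Fin n} → Adj G v w → 0 < degree G v
neighbour⇒0<degree {n} G {v} {w} e = begin
  1                           ≡⟨ 𝟙-yes (adj? G v w) e ⟨
  𝟙 (adj? G v w)              ≤⟨ term≤∑ (λ w → 𝟙 (adj? G v w)) w ⟩
  ∑[ w < n ] 𝟙 (adj? G v w)   ≡⟨ degree-∑ G v ⟨
  degree G v                  ∎
  where open ≤-Reasoning

degree-mono : (F : Graph k) (G : Graph l) (φ : Fin k ↔ Fin l) → PreservesAdj F G φ →
  ∀ v → degree F v ≤ degree G (to φ v)
degree-mono {k} {l} F G φ φ-adj v = begin
  degree F v                                ≡⟨ degree-∑ F v ⟩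
  ∑[ w < k ] 𝟙 (adj? F v w)                 ≤⟨ ∑-mono (λ w → 𝟙-mono (adj? F v w) (adj? G (to φ v) (to φ w)) (φ-adj v w)) ⟩
  ∑[ w < k ] 𝟙 (adj? G (to φ v) (to φ w))   ≡⟨ ∑-permute (λ w → 𝟙 (adj? G (to φ v) w)) φ ⟨
  ∑[ w < l ] 𝟙 (adj? G (to φ v) w)          ≡⟨ degree-∑ G (to φ v) ⟨
  degree G (to φ v)                         ∎
  where open ≤-Reasoning

module _ (F : SimpleGraph k) (G : SimpleGraph l) where

  degree-⊕ˡ : ∀ v → degree (graph F) v ≤ degree (graph (F ⊕ G)) (v ↑ˡ l)
  degree-⊕ˡ v = begin
    degree (graph F) v                                          ≡⟨ degree-∑ (graph F) v ⟩
    ∑[ w < k ] 𝟙 (adj? (graph F) v w) ≤⟨ ∑-mono (λ w → 𝟙-mono (adj? (graph F) v w) (adj? (graph (F ⊕ G)) (v ↑ˡ l) (w ↑ˡ l))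
      λ e → subst₂ (Pointwise _ _) (sym (splitAt-↑ˡ k v l)) (sym (splitAt-↑ˡ k w l)) (inj₁ e)) ⟩
    ∑[ w < k ] 𝟙 (adj? (graph (F ⊕ G)) (v ↑ˡ l) (w ↑ˡ l))       ≤⟨ m≤m+n _ _ ⟩
    _                                                           ≡⟨ ∑-↑ k (λ w → 𝟙 (adj? (graph (F ⊕ G)) (v ↑ˡ l) w)) ⟨
    ∑[ w < k + l ] 𝟙 (adj? (graph (F ⊕ G)) (v ↑ˡ l) w)          ≡⟨ degree-∑ (graph (F ⊕ G)) (v ↑ˡ l) ⟨
    degree (graph (F ⊕ G)) (v ↑ˡ l)                             ∎
    where open ≤-Reasoning

  degree-⊕ʳ : ∀ v → degree (graph G) v ≤ degree (graph (F ⊕ G)) (k ↑ʳ v)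
  degree-⊕ʳ v = begin
    degree (graph G) v                                          ≡⟨ degree-∑ (graph G) v ⟩
    ∑[ w < l ] 𝟙 (adj? (graph G) v w) ≤⟨ ∑-mono (λ w → 𝟙-mono (adj? (graph G) v w) (adj? (graph (F ⊕ G)) (k ↑ʳ v) (k ↑ʳ w))
      λ e → subst₂ (Pointwise _ _) (sym (splitAt-↑ʳ k l v)) (sym (splitAt-↑ʳ k l w)) (inj₂ e)) ⟩
    ∑[ w < l ] 𝟙 (adj? (graph (F ⊕ G)) (k ↑ʳ v) (k ↑ʳ w))       ≤⟨ m≤n+m _ _ ⟩
    _                                                           ≡⟨ ∑-↑ k (λ w → 𝟙 (adj? (graph (F ⊕ G)) (k ↑ʳ v) w)) ⟨
    ∑[ w < k + l ] 𝟙 (adj? (graph (F ⊕ G)) (k ↑ʳ v) w)          ≡⟨ degree-∑ (graph (F ⊕ G)) (k ↑ʳ v) ⟨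
    degree (graph (F ⊕ G)) (k ↑ʳ v)                             ∎
    where open ≤-Reasoning

degree-centre : ∀ k → degree (graph K[ 1 , k ]) zero ≡ k
degree-centre k = begin
  degree (graph K[ 1 , k ]) zero                              ≡⟨ degree-∑ (graph K[ 1 , k ]) zero ⟩
  ∑[ i < k ] 𝟙 (adj? (graph K[ 1 , k ]) zero (suc i))         ≡⟨ ∑-const k 1 ⟩
  k * 1                                                       ≡⟨ *-identityʳ k ⟩
  k                                                           ∎
  where open ≡-Reasoning

forest-degrees : ∀ ks D → (∀ v → degree (graph (forest ks)) v ≤ D) → All (_≤ D) ks
forest-degrees []       D deg≤D = []
forest-degrees (k ∷ ks) D deg≤D =
  subst (_≤ D) (degree-centre k) (≤-trans (degree-⊕ˡ K[ 1 , k ] (forest ks) zero) (deg≤D zero)) ∷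
  forest-degrees ks D λ v → ≤-trans (degree-⊕ʳ K[ 1 , k ] (forest ks) v) (deg≤D (1 + k ↑ʳ v))

-- Homomorphisms from star forests

hom-K₀ : (H : Graph m) → hom (K 0) H ≡ 1
hom-K₀ {m} H = trans (hom-∑ᶠ (K 0) H) (cong (_+ 0) (𝟙-yes (isHom? (graph (K 0)) H (finToFun {m} {0} zero)) λ ()))

*-≤-≡ : ∀ {x y z w} → x ≤ y → z ≤ w → 0 < y → 0 < w → x * z ≡ y * w → x ≡ y × z ≡ w
*-≤-≡ {x} {y} {z} {w} x≤y z≤w 0<y 0<w eq =
  ≤-antisym x≤y (≮⇒≥ λ x<y → <⇒≢ (≤-<-trans (*-monoʳ-≤ x z≤w) (*-monoˡ-< w {{>-nonZero 0<w}} x<y)) eq) ,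
  ≤-antisym z≤w (≮⇒≥ λ z<w → <⇒≢ (≤-<-trans (*-monoˡ-≤ z x≤y) (*-monoʳ-< y {{>-nonZero 0<y}} z<w)) eq)

module _ (H : Graph m) where

  private
    u : ℕ → ℕ
    u = starHom H

    hom-forest-^ : ∀ k ks e → hom (forest (k ∷ ks)) H ^ e ≡ u k ^ e * hom (forest ks) H ^ e
    hom-forest-^ k ks e = trans
      (cong (_^ e) (trans (hom-⊕ K[ 1 , k ] (forest ks) H) (cong (_* hom (forest ks) H) (hom-star k H))))
      (^-distribʳ-* e (u k) (hom (forest ks) H))

  open Roots u

  -- `k ⊑ T` says that per vertex K[1,k] contributes at most as much as K[1,T]; under multiplication
  -- the exponents k + 1 add up to the number of vertices.
  hom-forest-≤ : ∀ T {ks} → All (_⊑ T) ks → hom (forest ks) H ^ suc T ≤ u T ^ size ks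
  hom-forest-≤ T []                 = ≤-reflexive (trans (cong (_^ suc T) (hom-K₀ H)) (^-zeroˡ (suc T)))
  hom-forest-≤ T (_∷_ {k} {ks} p ps) = begin
    hom (forest (k ∷ ks)) H ^ suc T          ≡⟨ hom-forest-^ k ks (suc T) ⟩
    u k ^ suc T * hom (forest ks) H ^ suc T  ≤⟨ *-mono-≤ p (hom-forest-≤ T ps) ⟩
    u T ^ suc k * u T ^ size ks              ≡⟨ ^-distribˡ-+-* (u T) (suc k) (size ks) ⟨
    u T ^ size (k ∷ ks)                      ∎
    where open ≤-Reasoning

  hom-forest-≡⁻ : ∀ T → 0 < u T → ∀ {ks} → All (_⊑ T) ks → hom (forest ks) H ^ suc T ≡ u T ^ size ks →
    All (λ k → u k ^ suc T ≡ u T ^ suc k) ks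
  hom-forest-≡⁻ T 0<uT [] eq = []
  hom-forest-≡⁻ T 0<uT (_∷_ {k} {ks} p ps) eq
    with head , tail ← *-≤-≡ p (hom-forest-≤ T ps) (m^n>0 (u T) {{>-nonZero 0<uT}} (suc k)) (m^n>0 (u T) {{>-nonZero 0<uT}} (size ks))
      (trans (sym (hom-forest-^ k ks (suc T))) (trans eq (^-distribˡ-+-* (u T) (suc k) (size ks)))) =
    head ∷ hom-forest-≡⁻ T 0<uT ps tail

splitAt-injective : ∀ {i j : Fin (k + l)} {x} → splitAt k i ≡ x → splitAt k j ≡ x → i ≡ j
splitAt-injective {k} {l} {i} {j} p q =
  trans (sym (join-splitAt k l i)) (trans (cong (join k l) (trans p (sym q))) (join-splitAt k l j))

-- Every edge that could be added to F destroys a homomorphism, so F is the only graph with F as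
-- spanning subgraph that keeps the count `hom F H`.
Separates : Graph m → SimpleGraph n → Set
Separates {m} {n} H F = ∀ {i j} → ¬ Adj (graph F) i j → i ≢ j →
  ∃ λ f → IsHom (graph F) H f × ¬ Adj H (f i) (f j)

-- The two neighbours may coincide, in an unlooped vertex.
OpenNeighbourhood : Graph m → Set
OpenNeighbourhood H = ∃ λ v → ∃ λ x → ∃ λ y → Adj H v x × Adj H v y × ¬ Adj H x y

module _ (F : SimpleGraph n) (G : SimpleGraph l) (H : Graph m) (φ : Fin n ↔ Fin l)
         (φ-adj : PreservesAdj (graph F) (graph G) φ) (separates : Separates H F) where

  hom-≡⇒≃ : hom G H ≡ hom F H → F ≃ G
  hom-≡⇒≃ eq = mk≃ (mkRelIso φ λ v w → mk⇔ (φ-adj v w) λ e → decidable-stable (adj? (graph F) v w) λ ¬e →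
    let f , f-hom , ¬fvw = separates ¬e λ where refl → loopless G _ e
    in <⇒≢ (hom-anti-< F G H φ φ-adj f f-hom λ h → ¬fvw
      (subst₂ (λ x y → Adj H (f x) (f y)) (strictlyInverseʳ φ v) (strictlyInverseʳ φ w) (h _ _ e))) eq)

module _ (H : Graph m) (neighbour : ∀ x → ∃ λ y → Adj H x y) where

  -- The star is folded onto an edge of H at `x`: centre to one end, all leaves to the other.
  star-extend : ∀ {k} (i : Fin (1 + k)) x → ∃ λ f → IsHom (graph K[ 1 , k ]) H f × f i ≡ x
  star-extend zero    x with y , e ← neighbour x =
    x F.∷ (λ _ → y) , isHom-star⁺ H _ (λ _ → e) , refl
  star-extend (suc i) x with y , e ← neighbour x =
    y F.∷ (λ _ → x) , isHom-star⁺ H _ (λ _ → adj-sym H e) , refl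

  forest-hom : Fin m → ∀ ks → ∃ (IsHom (graph (forest ks)) H)
  forest-hom x []       = (λ ()) , λ ()
  forest-hom x (k ∷ ks)
    with f , f-hom , _ ← star-extend {k} zero x
    with g , g-hom ← forest-hom x ks = f F.++ g , ++-isHom K[ 1 , k ] (forest ks) H f g f-hom g-hom

  forest-extend : ∀ ks (i : Fin (size ks)) x → ∃ λ f → IsHom (graph (forest ks)) H f × f i ≡ x
  forest-extend (k ∷ ks) i x with splitAt (1 + k) i in eq
  ... | inj₁ i′
    with f , f-hom , fi≡x ← star-extend i′ x
    with g , g-hom ← forest-hom x ks =
    f F.++ g , ++-isHom K[ 1 , k ] (forest ks) H f g f-hom g-hom , trans (cong [ f , g ]′ eq) fi≡x
  ... | inj₂ i′
    with f , f-hom , _ ← star-extend {k} zero x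
    with g , g-hom , gi≡x ← forest-extend ks i′ x =
    f F.++ g , ++-isHom K[ 1 , k ] (forest ks) H f g f-hom g-hom , trans (cong [ f , g ]′ eq) gi≡x

  -- Distinct non-adjacent vertices of a star are two leaves. The centre goes to the vertex with the
  -- open neighbourhood and the two leaves to its non-adjacent neighbours; a star with one leaf has
  -- no such pair.
  star-separates : ∀ k → k ≡ 1 ⊎ OpenNeighbourhood H → Separates H K[ 1 , k ]
  star-separates k c {zero}  {zero}  ¬e i≢j = contradiction refl i≢j
  star-separates k c {zero}  {suc j} ¬e i≢j = contradiction (λ ()) ¬e
  star-separates k c {suc i} {zero}  ¬e i≢j = contradiction (λ ()) ¬e
  star-separates _ (inj₁ refl) {suc zero} {suc zero} ¬e i≢j = contradiction refl i≢j
  star-separates k (inj₂ (v , x , y , v~x , v~y , x≁y)) {suc i} {suc j} ¬e i≢j =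
    f , isHom-star⁺ H f leaf , λ e → x≁y (subst₂ (Adj H) fi≡x fj≡y e)
    where
    g : Fin k → Fin m
    g l with l ≟ i
    ... | yes _ = x
    ... | no  _ = y
    f : Fin (1 + k) → Fin m
    f = v F.∷ g
    leaf : ∀ l → Adj H v (g l)
    leaf l with l ≟ i
    ... | yes _ = v~x
    ... | no  _ = v~y
    fi≡x : g i ≡ x
    fi≡x with i ≟ i
    ... | yes _  = refl
    ... | no i≢i = contradiction refl i≢i
    fj≡y : g j ≡ y
    fj≡y with j ≟ i
    ... | yes j≡i = contradiction (cong suc (sym j≡i)) i≢j
    ... | no _    = refl

  module _ {x y : Fin m} (x≁y : ¬ Adj H x y) where

    -- Vertices of different stars are sent to `x` and `y` independently; a pair within one star is
    -- separated there and the map extended to the rest.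
    forest-separates : ∀ ks → All (λ k → k ≡ 1 ⊎ OpenNeighbourhood H) ks → Separates H (forest ks)
    forest-separates (k ∷ ks) (c ∷ cs) {i} {j} ¬e i≢j = separate (splitAt (1 + k) i) (splitAt (1 + k) j) refl refl
      where
      glue = ++-isHom K[ 1 , k ] (forest ks) H
      separate : ∀ p q → splitAt (1 + k) i ≡ p → splitAt (1 + k) j ≡ q →
        ∃ λ f → IsHom (graph (forest (k ∷ ks))) H f × ¬ Adj H (f i) (f j)
      separate (inj₁ i′) (inj₁ j′) p q
        with f , f-hom , f-sep ← star-separates k c {i′} {j′}
          (λ e → ¬e (subst₂ (Pointwise _ _) (sym p) (sym q) (inj₁ e)))
          (λ where refl → i≢j (splitAt-injective p q))
        with g , g-hom ← forest-hom x ks =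
        f F.++ g , glue f g f-hom g-hom , λ e → f-sep (subst₂ (λ s t → Adj H ([ f , g ]′ s) ([ f , g ]′ t)) p q e)
      separate (inj₂ i′) (inj₂ j′) p q
        with f , f-hom , _ ← star-extend {k} zero x
        with g , g-hom , g-sep ← forest-separates ks cs {i′} {j′}
          (λ e → ¬e (subst₂ (Pointwise _ _) (sym p) (sym q) (inj₂ e)))
          (λ where refl → i≢j (splitAt-injective p q)) =
        f F.++ g , glue f g f-hom g-hom , λ e → g-sep (subst₂ (λ s t → Adj H ([ f , g ]′ s) ([ f , g ]′ t)) p q e)
      separate (inj₁ i′) (inj₂ j′) p q
        with f , f-hom , refl ← star-extend i′ x
        with g , g-hom , refl ← forest-extend ks j′ y =
        f F.++ g , glue f g f-hom g-hom , λ e → x≁y (subst₂ (λ s t → Adj H ([ f , g ]′ s) ([ f , g ]′ t)) p q e)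
      separate (inj₂ i′) (inj₁ j′) p q
        with f , f-hom , refl ← star-extend j′ y
        with g , g-hom , refl ← forest-extend ks i′ x =
        f F.++ g , glue f g f-hom g-hom , λ e → x≁y (subst₂ (λ s t → Adj H ([ f , g ]′ s) ([ f , g ]′ t)) p q e)

-- Copies

hom-copies : ∀ c (F : SimpleGraph k) (H : Graph m) → hom (copies c F) H ≡ hom F H ^ c
hom-copies zero    F H = hom-K₀ H
hom-copies (suc c) F H = trans (hom-⊕ F (copies c F) H) (cong (hom F H *_) (hom-copies c F H))

copies-cong : ∀ c {F : SimpleGraph k} {G : SimpleGraph l} → F ≃ G → copies c F ≃ copies c G
copies-cong zero    i = ≃-refl
copies-cong (suc c) i = ⊕-cong i (copies-cong c i)

forest-constant : ∀ T {ks} → All (_≡ T) ks → ∃ λ c → forest ks ≃ copies c K[ 1 , T ]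
forest-constant T []          = 0 , ≃-refl
forest-constant T (refl ∷ ps) with c , i ← forest-constant T ps = suc c , ⊕-cong (≃-refl {F = K[ 1 , T ]}) i

forest-two-sizes : ∀ S T {ks} → All (λ k → k ≡ S ⊎ k ≡ T) ks →
  ∃ λ a → ∃ λ b → forest ks ≃ copies a K[ 1 , S ] ⊕ copies b K[ 1 , T ]
forest-two-sizes S T [] = 0 , 0 , mk≃ (mkRelIso ↔-refl λ ())
forest-two-sizes S T (inj₁ refl ∷ ps) with a , b , i ← forest-two-sizes S T ps =
  suc a , b , ≃-trans (⊕-cong (≃-refl {F = K[ 1 , S ]}) i) (≃-sym (⊕-assoc K[ 1 , S ] (copies a K[ 1 , S ]) (copies b K[ 1 , T ])))
forest-two-sizes S T (inj₂ refl ∷ ps) with a , b , i ← forest-two-sizes S T ps =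
  a , suc b , ≃-trans (⊕-cong (≃-refl {F = K[ 1 , T ]}) i) (⊕-swap K[ 1 , T ] (copies a K[ 1 , S ]) (copies b K[ 1 , T ]))

-- Degrees of the target graph

degree≤maxDegree : (H : Graph m) (v : Fin m) → degree H v ≤ maxDegree H
degree≤maxDegree H v = All.lookup (xs≤max 0 (List.map (degree H) (allFin _))) (∈-map⁺ (degree H) (∈-allFin v))

-- `max` starts from the default 0; positivity ensures that the maximum comes from a vertex.
maxDegree-attained : (H : Graph m) → 0 < maxDegree H → ∃ λ v → degree H v ≡ maxDegree H
maxDegree-attained H 0<Δ with argmax-sel id 0 (List.map (degree H) (allFin _))
... | inj₁ Δ≡0 = contradiction Δ≡0 (n>0⇒n≢0 0<Δ)
... | inj₂ Δ∈ with v , _ , eq ← ∈-map⁻ (degree H) Δ∈ = v , sym eq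

degree≤order : (H : Graph m) (v : Fin m) → degree H v ≤ m
degree≤order {m} H v = begin
  degree H v                  ≡⟨ degree-∑ H v ⟩
  ∑[ w < m ] 𝟙 (adj? H v w)   ≤⟨ ∑-mono (λ w → 𝟙-≤1 (adj? H v w)) ⟩
  ∑[ w < m ] 1                ≡⟨ trans (∑-const m 1) (*-identityʳ m) ⟩
  m                           ∎
  where open ≤-Reasoning

degree<order : (H : Graph m) {v w : Fin m} → ¬ Adj H v w → degree H v < m
degree<order {m} H {v} {w} ¬e = begin-strict
  degree H v                  ≡⟨ degree-∑ H v ⟩
  ∑[ w < m ] 𝟙 (adj? H v w)   <⟨ ∑-mono-< (λ w → 𝟙-≤1 (adj? H v w)) w (≤-reflexive (cong suc (𝟙-no (adj? H v w) ¬e))) ⟩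
  ∑[ w < m ] 1                ≡⟨ trans (∑-const m 1) (*-identityʳ m) ⟩
  m                           ∎
  where open ≤-Reasoning

complete⇒order≤maxDegree : (H : Graph m) → (∀ v w → Adj H v w) → m ≤ maxDegree H
complete⇒order≤maxDegree {zero}      H complete = z≤n
complete⇒order≤maxDegree {m@(suc _)} H complete = begin
  m                              ≡⟨ trans (∑-const m 1) (*-identityʳ m) ⟨
  ∑[ w < m ] 1                   ≡⟨ sum-cong-≗ (λ w → 𝟙-yes (adj? H zero w) (complete zero w)) ⟨
  ∑[ w < m ] 𝟙 (adj? H zero w)   ≡⟨ degree-∑ H zero ⟨
  degree H zero                  ≤⟨ degree≤maxDegree H zero ⟩
  maxDegree H                    ∎
  where open ≤-Reasoning

complete⇒≅Kˡᵒᵒᵖ : (H : Graph m) → (∀ v w → Adj H v w) → H ≅ Kˡᵒᵒᵖ (maxDegree H)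
complete⇒≅Kˡᵒᵒᵖ {m} H complete = relabel (maxDegree H) (≤-antisym (complete⇒order≤maxDegree H complete) Δ≤m)
  where
  relabel : ∀ k → m ≡ k → H ≅ Kˡᵒᵒᵖ k
  relabel _ refl = ↔-refl , λ v w → mk⇔ (λ _ → _) (λ _ → complete v w)
  Δ≤m : maxDegree H ≤ m
  Δ≤m with maxDegree H in eq
  ... | zero  = z≤n
  ... | suc _ with v , p ← maxDegree-attained H (subst (0 <_) (sym eq) z<s) = subst (_≤ m) (trans p eq) (degree≤order H v)

nonAdjacentPair : (H : Graph m) → ¬ (∀ v w → Adj H v w) → ∃ λ v → ∃ λ w → ¬ Adj H v w
nonAdjacentPair H ¬complete with v , ¬v ← ¬∀⟶∃¬ _ _ (λ v → all? (adj? H v)) ¬complete = v , ¬∀⟶∃¬ _ _ (adj? H v) ¬v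

powerSum₁ : (f : Vector ℕ n) → powerSum f 1 ≡ sum f
powerSum₁ f = sum-cong-≗ λ i → *-identityʳ (f i)

module _ (f : Vector ℕ n) (B : ℕ) (f≤B : ∀ i → f i ≤ B) where

  private
    term : ∀ j i → f i ^ suc j ≤ B ^ j * f i ^ 1
    term j i = subst₂ _≤_ (*-comm (f i ^ j) (f i)) (cong (B ^ j *_) (sym (*-identityʳ (f i))))
      (*-monoˡ-≤ (f i) (^-monoˡ-≤ j (f≤B i)))

    term-< : ∀ j i → 0 < f i → f i < B → f i ^ suc (suc j) < B ^ suc j * f i ^ 1
    term-< j i 0<fi fi<B = subst₂ _<_ (*-comm (f i ^ suc j) (f i)) (cong (B ^ suc j *_) (sym (*-identityʳ (f i))))
      (*-monoˡ-< (f i) {{>-nonZero 0<fi}} (^-monoˡ-< (suc j) fi<B))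

    factor : ∀ j → ∑[ i < n ] (B ^ j * f i ^ 1) ≡ B ^ j * powerSum f 1
    factor j = sym (*-distribˡ-sum (B ^ j) (λ i → f i ^ 1))

  powerSum-bound : ∀ j → powerSum f (suc j) ≤ B ^ j * powerSum f 1
  powerSum-bound j = ≤-trans (∑-mono (term j)) (≤-reflexive (factor j))

  powerSum-bound-< : ∀ j i → 0 < f i → f i < B → powerSum f (suc (suc j)) < B ^ suc j * powerSum f 1
  powerSum-bound-< j i 0<fi fi<B = <-≤-trans (∑-mono-< (term (suc j)) i (term-< j i 0<fi fi<B)) (≤-reflexive (factor (suc j)))

-- Existence of the threshold

-- The two leading terms of the binomial expansion.
bernoulli : ∀ s i → s ^ suc i + suc i * s ^ i ≤ suc s ^ suc i
bernoulli s zero    = ≤-reflexive (identity s)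
  where
  identity : ∀ s → s * 1 + 1 * 1 ≡ suc s * 1
  identity = solve-∀
bernoulli s (suc i) = begin
  s ^ suc (suc i) + suc (suc i) * s ^ suc i                   ≤⟨ m≤m+n _ (suc i * s ^ i) ⟩
  s ^ suc (suc i) + suc (suc i) * s ^ suc i + suc i * s ^ i   ≡⟨ identity s i (s ^ i) ⟩
  suc s * (s ^ suc i + suc i * s ^ i)                         ≤⟨ *-monoʳ-≤ (suc s) (bernoulli s i) ⟩
  suc s ^ suc (suc i)                                         ∎
  where
  open ≤-Reasoning
  identity : ∀ s i p → s * (s * p) + suc (suc i) * (s * p) + suc i * p ≡ suc s * (s * p + suc i * p)
  identity = solve-∀

eventually-larger : ∀ s → 0 < s → ∃ λ j → 2 ≤ j × s ^ suc j < suc s ^ j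
eventually-larger s 0<s = suc i , s≤s (s≤s z≤n) , (begin-strict
  s ^ suc (suc i)             ≡⟨ *-assoc s s (s ^ i) ⟨
  s * s * s ^ i               ≤⟨ *-monoˡ-≤ (s ^ i) (m≤n+m (s * s) 2) ⟩
  suc i * s ^ i               <⟨ m<n+m _ (m^n>0 s {{>-nonZero 0<s}} (suc i)) ⟩
  s ^ suc i + suc i * s ^ i   ≤⟨ bernoulli s i ⟩
  suc s ^ suc i               ∎)
  where
  open ≤-Reasoning
  -- Large enough that the coefficient i + 1 of `s ^ i` in `bernoulli` is at least s².
  i = suc (s * s)

module _ {P : ℕ → Set} (P? : ∀ k → Dec (P k)) where

  leastBelow : ∀ n → (∃ λ k → P k × (∀ j → P j → k ≤ j)) ⊎ (∀ j → j < n → ¬ P j)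
  leastBelow zero = inj₂ λ _ ()
  leastBelow (suc n) with leastBelow n
  ... | inj₁ l = inj₁ l
  ... | inj₂ none with P? n
  ...   | yes p = inj₁ (n , p , λ j Pj → ≮⇒≥ λ j<n → none j j<n Pj)
  ...   | no ¬p = inj₂ λ j j<1+n Pj → [ (λ j<n → none j j<n Pj) , (λ where refl → ¬p Pj) ]′ (m≤n⇒m<n∨m≡n (s≤s⁻¹ j<1+n))

  least : ∀ n → P n → ∃ λ k → P k × (∀ j → P j → k ≤ j)
  least n Pn with leastBelow (suc n)
  ... | inj₁ l    = l
  ... | inj₂ none = contradiction Pn (none n ≤-refl)

-- The counts hom(K[1,k],H)

^-injectiveˡ : ∀ e {x y} → x ^ suc e ≡ y ^ suc e → x ≡ y
^-injectiveˡ e {x} {y} eq = ≤-antisym (^-cancelʳ-≤ e x y (≤-reflexive eq)) (^-cancelʳ-≤ e y x (≤-reflexive (sym eq)))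

module _ (H : Graph m) (noIsolated : NoIsolated H) where

  neighbour : ∀ x → ∃ λ y → Adj H x y
  neighbour x with any? (adj? H x)
  ... | yes e = e
  ... | no ¬e = contradiction (λ w e → ¬e (w , e)) (noIsolated x)

  degree>0 : ∀ x → 0 < degree H x
  degree>0 x = neighbour⇒0<degree H (proj₂ (neighbour x))

  private
    u : ℕ → ℕ
    u = starHom H

  open Roots u

  u-convex : ∀ k → u (suc k) ^ 2 ≤ u k * u (suc (suc k))
  u-convex k = subst₂ _≤_ (cong (_^ 2) (sym (starHom-powerSum H (suc k))))
    (cong₂ _*_ (sym (starHom-powerSum H k)) (sym (starHom-powerSum H (suc (suc k)))))
    (powerSum-logConvex (degree H) k)

  u-convex-< : ∀ {i j} → degree H i ≢ degree H j → ∀ k → u (suc k) ^ 2 < u k * u (suc (suc k))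
  u-convex-< {i} {j} i≢j k = subst₂ _<_ (cong (_^ 2) (sym (starHom-powerSum H (suc k))))
    (cong₂ _*_ (sym (starHom-powerSum H k)) (sym (starHom-powerSum H (suc (suc k)))))
    (powerSum-logConvex-< (degree H) k degree>0 i j i≢j)

  degree^≤u : ∀ x k → degree H x ^ k ≤ u k
  degree^≤u x k = subst (degree H x ^ k ≤_) (sym (starHom-powerSum H k)) (term≤∑ (λ x → degree H x ^ k) x)

  u>0 : Fin m → ∀ k → 0 < u k
  u>0 x k = ≤-trans (m^n>0 (degree H x) {{>-nonZero (degree>0 x)}} k) (degree^≤u x k)

  u₁≡∑degree : u 1 ≡ sum (degree H)
  u₁≡∑degree = trans (starHom-powerSum H 1) (powerSum₁ (degree H))

  private
    Δ = maxDegree H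

  -- If all m degrees were at least Δ, then mΔ ≤ u 1 ≤ Δ² would force m ≤ Δ. The first alternative
  -- contradicts this by Δ ≤ `degree H x` < m; the second sharpens it to m < Δ, against Δ ≤ m.
  smaller-degree : ∀ {x} → degree H x < m ⊎ u 1 < Δ * Δ → u 1 ≤ Δ * Δ → 0 < Δ → ∃ λ v → degree H v < Δ
  smaller-degree {x} strict u₁≤Δ² 0<Δ with any? (λ v → degree H v <? Δ)
  ... | yes p = p
  ... | no ¬p = contradiction (m<Δ strict) (≤⇒≯ Δ≤m)
    where
    Δ≤degree : ∀ v → Δ ≤ degree H v
    Δ≤degree v = ≮⇒≥ λ p → ¬p (v , p)
    Δ≤m : Δ ≤ m
    Δ≤m = ≤-trans (Δ≤degree x) (degree≤order H x)
    mΔ≤u₁ : m * Δ ≤ u 1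
    mΔ≤u₁ = subst₂ _≤_ (∑-const m Δ) (sym u₁≡∑degree) (∑-mono Δ≤degree)
    m<Δ : degree H x < m ⊎ u 1 < Δ * Δ → m < Δ
    m<Δ (inj₁ d<m) = contradiction (≤-<-trans (Δ≤degree x) d<m)
      (≤⇒≯ (*-cancelʳ-≤ m Δ Δ {{>-nonZero 0<Δ}} (≤-trans mΔ≤u₁ u₁≤Δ²)))
    m<Δ (inj₂ u₁<Δ²) = *-cancelʳ-< Δ m Δ (≤-<-trans mΔ≤u₁ u₁<Δ²)

  -- Squaring u t ≤ Δ^(t-1) u 1 produces powers of Δ², which are bounded by powers of u 1.
  -- Strictness comes from Δ² < u 1 or, when these agree, from a vertex of degree below Δ, which the
  -- non-adjacent pair provides.
  edge-dominates : ∀ {x y} → ¬ Adj H x y → Δ ^ 2 ≤ u 1 → ∀ j → suc (suc j) ⊏ 1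
  edge-dominates {x} {y} x≁y Δ²≤u₁ j = [ slack , tight ]′ (m≤n⇒m<n∨m≡n Δ²≤u₁)
    where
    open ≤-Reasoning
    t = suc (suc j)
    instance
      u₁²≢0 : NonZero (u 1 ^ 2)
      u₁²≢0 = m^n≢0 (u 1) 2 {{>-nonZero (u>0 x 1)}}
    u≤ : u t ≤ Δ ^ suc j * u 1
    u≤ = subst₂ _≤_ (sym (starHom-powerSum H t)) (cong (Δ ^ suc j *_) (sym (starHom-powerSum H 1)))
      (powerSum-bound (degree H) Δ (degree≤maxDegree H) (suc j))
    collect : u 1 ^ suc j * u 1 ^ 2 ≡ u 1 ^ suc t
    collect = trans (sym (^-distribˡ-+-* (u 1) (suc j) 2)) (cong (u 1 ^_) (+-comm (suc j) 2))
    square : (Δ ^ suc j * u 1) ^ 2 ≡ (Δ ^ 2) ^ suc j * u 1 ^ 2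
    square = trans (^-distribʳ-* 2 (Δ ^ suc j) (u 1)) (cong (_* u 1 ^ 2) (^-^-comm Δ (suc j) 2))
    slack : Δ ^ 2 < u 1 → t ⊏ 1
    slack Δ²<u₁ = begin-strict
      u t ^ 2                    ≤⟨ ^-monoˡ-≤ 2 u≤ ⟩
      (Δ ^ suc j * u 1) ^ 2      ≡⟨ square ⟩
      (Δ ^ 2) ^ suc j * u 1 ^ 2  <⟨ *-monoˡ-< (u 1 ^ 2) (^-monoˡ-< (suc j) Δ²<u₁) ⟩
      u 1 ^ suc j * u 1 ^ 2      ≡⟨ collect ⟩
      u 1 ^ suc t                ∎
    tight : Δ ^ 2 ≡ u 1 → t ⊏ 1
    tight Δ²≡u₁ with v , dv<Δ ← smaller-degree {x} (inj₁ (degree<order H x≁y))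
                       (≤-reflexive (trans (sym Δ²≡u₁) (cong (Δ *_) (*-identityʳ Δ))))
                       (≤-trans (degree>0 x) (degree≤maxDegree H x)) = begin-strict
      u t ^ 2                    <⟨ ^-monoˡ-< 2 (subst₂ _<_ (sym (starHom-powerSum H t)) (cong (Δ ^ suc j *_) (sym (starHom-powerSum H 1)))
                                      (powerSum-bound-< (degree H) Δ (degree≤maxDegree H) j v (degree>0 v) dv<Δ)) ⟩
      (Δ ^ suc j * u 1) ^ 2      ≡⟨ square ⟩
      (Δ ^ 2) ^ suc j * u 1 ^ 2  ≡⟨ cong (λ x → x ^ suc j * u 1 ^ 2) Δ²≡u₁ ⟩
      u 1 ^ suc j * u 1 ^ 2      ≡⟨ collect ⟩
      u 1 ^ suc t                ∎

  module _ (u₁<Δ² : u 1 < Δ ^ 2) where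

    private
      Δ²≡Δ*Δ : Δ ^ 2 ≡ Δ * Δ
      Δ²≡Δ*Δ = cong (Δ *_) (*-identityʳ Δ)

      0<Δ : 0 < Δ
      0<Δ = n≢0⇒n>0 λ Δ≡0 → contradiction (subst (λ x → u 1 < x ^ 2) Δ≡0 u₁<Δ²) λ ()

    apex : ∃ λ v → degree H v ≡ Δ
    apex = maxDegree-attained H 0<Δ

    unequal-degrees : ∃ λ i → ∃ λ j → degree H i ≢ degree H j
    unequal-degrees with w , dw≡Δ ← apex
      with v , dv<Δ ← smaller-degree {w} (inj₂ (subst (u 1 <_) Δ²≡Δ*Δ u₁<Δ²)) (<⇒≤ (subst (u 1 <_) Δ²≡Δ*Δ u₁<Δ²)) 0<Δ =
      v , w , λ eq → <⇒≢ dv<Δ (trans eq dw≡Δ)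

    -- If the neighbourhood of a vertex of degree Δ were a looped clique, each of its Δ members
    -- would have degree at least Δ, and the degree sum u 1 would reach Δ².
    openNeighbourhood : OpenNeighbourhood H
    openNeighbourhood with v , dv≡Δ ← apex
      with any? (λ x → any? λ y → adj? H v x ×-dec adj? H v y ×-dec ¬? (adj? H x y))
    ... | yes (x , y , p) = v , x , y , p
    ... | no ¬p = contradiction (begin
      Δ ^ 2                                ≡⟨ Δ²≡Δ*Δ ⟩
      Δ * Δ                                ≡⟨ cong (_* Δ) (trans (sym dv≡Δ) (degree-∑ H v)) ⟩
      ∑[ x < m ] 𝟙 (adj? H v x) * Δ        ≡⟨ *-distribʳ-sum Δ (λ x → 𝟙 (adj? H v x)) ⟩
      ∑[ x < m ] (𝟙 (adj? H v x) * Δ)      ≤⟨ ∑-mono (λ x → term x (adj? H v x)) ⟩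
      sum (degree H)                       ≡⟨ u₁≡∑degree ⟨
      u 1                                  ∎) (<⇒≱ u₁<Δ²)
      where
      open ≤-Reasoning
      closed : ∀ {x y} → Adj H v x → Adj H v y → Adj H x y
      closed {x} {y} v~x v~y = decidable-stable (adj? H x y) λ x≁y → ¬p (x , y , v~x , v~y , x≁y)
      term : ∀ x (e? : Dec (Adj H v x)) → 𝟙 e? * Δ ≤ degree H x
      term x (no _)    = z≤n
      term x (yes v~x) = begin
        1 * Δ                       ≡⟨ *-identityˡ Δ ⟩
        Δ                           ≡⟨ trans (sym dv≡Δ) (degree-∑ H v) ⟩
        ∑[ y < m ] 𝟙 (adj? H v y)   ≤⟨ ∑-mono (λ y → 𝟙-mono (adj? H v y) (adj? H x y) (closed v~x)) ⟩
        ∑[ y < m ] 𝟙 (adj? H x y)   ≡⟨ degree-∑ H x ⟨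
        degree H x                  ∎

    -- A single vertex of maximum degree already contributes Δ^j to u j, and Δ² ≥ u 1 + 1; so the
    -- square of u j grows at least like (u 1 + 1)^j, which eventually exceeds u 1 ^ (j + 1).
    star-beats-edge : ∀ j → u 1 ^ suc j < suc (u 1) ^ j → StarBeatsEdge H (suc j)
    star-beats-edge j larger = begin-strict
      hom (K 2) H ^ suc j        ≡⟨ cong (_^ suc j) (hom-K₂ H) ⟩
      u 1 ^ suc j                <⟨ larger ⟩
      suc (u 1) ^ j              ≤⟨ ^-monoˡ-≤ j u₁<Δ² ⟩
      (Δ ^ 2) ^ j                ≡⟨ ^-^-comm Δ 2 j ⟩
      (Δ ^ j) ^ 2                ≤⟨ ^-monoˡ-≤ 2 (subst (λ d → d ^ j ≤ u j) (proj₂ apex) (degree^≤u (proj₁ apex) j)) ⟩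
      u j ^ 2                    ≡⟨ cong (_^ 2) (hom-star j H) ⟨
      hom K[ 1 , j ] H ^ 2       ∎
      where open ≤-Reasoning

    threshold : ∃ (IsThreshold H)
    threshold
      with j , 2≤j , larger ← eventually-larger (u 1) (u>0 (proj₁ apex) 1)
      with k , (3≤k , beats) , minimal ← least (λ k → 3 ≤? k ×-dec (hom (K 2) H ^ k <? hom K[ 1 , k ∸ 1 ] H ^ 2))
             (suc j) (s≤s 2≤j , star-beats-edge j larger) =
      k , 3≤k , beats , λ i 3≤i b → minimal i (3≤i , b)

-- The extremal star

module _ (H : Graph m) (D : ℕ) where

  private
    u = starHom H

  open Roots u

  -- The maximum in boundPower is the entry of K[1,T]; T is 1 or D below.
  Dominant : ℕ → Set
  Dominant T = ∃ λ e → suc T * suc e ≡ 2 * (1 + D) × (∀ n → boundPower H n D ≡ (u T ^ n) ^ suc e)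

  boundPower-starHom : ∀ n → boundPower H n D ≡ (u 1 ^ suc D) ^ n ⊔ (u D ^ 2) ^ n
  boundPower-starHom n = cong₂ _⊔_
    (trans (cong (_^ (n * (1 + D))) (hom-K₂ H)) (power (u 1) (1 + D)))
    (trans (cong (_^ (n * 2)) (hom-star D H)) (power (u D) 2))
    where
    power : ∀ x e → x ^ (n * e) ≡ (x ^ e) ^ n
    power x e = trans (cong (x ^_) (*-comm n e)) (sym (^-*-assoc x e n))

  edge-dominant : D ⊑ 1 → Dominant 1
  -- The exponent 2 (1 + D) must factor as (T + 1) (e + 1): for T = 1 this gives e = D, for T = D it
  -- gives e = 1.
  edge-dominant D⊑1 = D , refl , λ n → trans (boundPower-starHom n)
    (trans (m≥n⇒m⊔n≡m (^-monoˡ-≤ n D⊑1)) (^-^-comm (u 1) (suc D) n))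

  star-dominant : 1 ⊑ D → Dominant D
  star-dominant 1⊑D = 1 , *-comm (suc D) 2 , λ n → trans (boundPower-starHom n)
    (trans (m≤n⇒m⊔n≡n (^-monoˡ-≤ n 1⊑D)) (^-^-comm (u D) 2 n))

  module _ {T : ℕ} (dominant : Dominant T) where

    private
      e = proj₁ dominant

      regroup : ∀ x → x ^ (2 * (1 + D)) ≡ (x ^ suc T) ^ suc e
      regroup x = trans (cong (x ^_) (sym (proj₁ (proj₂ dominant)))) (sym (^-*-assoc x (suc T) (suc e)))

    bounded : (G : SimpleGraph n) → hom G H ^ suc T ≤ u T ^ n → Bounded G H D
    bounded {n} G p = subst₂ _≤_ (sym (regroup (hom G H))) (sym (proj₂ (proj₂ dominant) n)) (^-monoˡ-≤ (suc e) p)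

    equality⁺ : (G : SimpleGraph n) → hom G H ^ suc T ≡ u T ^ n → Equality G H D
    equality⁺ {n} G p = trans (regroup (hom G H)) (trans (cong (_^ suc e) p) (sym (proj₂ (proj₂ dominant) n)))

    equality⁻ : (G : SimpleGraph n) → Equality G H D → hom G H ^ suc T ≡ u T ^ n
    equality⁻ {n} G p = ^-injectiveˡ e (trans (sym (regroup (hom G H))) (trans p (proj₂ (proj₂ dominant) n)))

    copies⇒equality : (G : SimpleGraph n) → (∃ λ c → G ≃ copies c K[ 1 , T ]) → Equality G H D
    copies⇒equality {n} G (c , i) = equality⁺ G (begin
      hom G H ^ suc T        ≡⟨ cong (_^ suc T) (trans (hom-≃ H i) (trans (hom-copies c K[ 1 , T ] H) (cong (_^ c) (hom-star T H)))) ⟩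
      (u T ^ c) ^ suc T      ≡⟨ ^-*-assoc (u T) c (suc T) ⟩
      u T ^ (c * suc T)      ≡⟨ cong (u T ^_) (↔⇒≡ (bijection (relIso i))) ⟨
      u T ^ n                ∎)
      where open ≡-Reasoning

    module _ (G : SimpleGraph n) {ks : List ℕ} (φ : Fin (size ks) ↔ Fin n)
             (φ-adj : PreservesAdj (graph (forest ks)) (graph G) φ) (below : All (_⊑ T) ks) where

      private
        G≤forest : hom G H ≤ hom (forest ks) H
        G≤forest = hom-anti (forest ks) G H φ φ-adj

        forest≤ : hom (forest ks) H ^ suc T ≤ u T ^ n
        forest≤ = subst (λ n → hom (forest ks) H ^ suc T ≤ u T ^ n) (↔⇒≡ φ) (hom-forest-≤ H T below)

      spanned⇒bounded : Bounded G H D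
      spanned⇒bounded = bounded G (≤-trans (^-monoˡ-≤ (suc T) G≤forest) forest≤)

      module _ (eq : Equality G H D) where

        private
          uTⁿ≤forest : u T ^ n ≤ hom (forest ks) H ^ suc T
          uTⁿ≤forest = ≤-trans (≤-reflexive (sym (equality⁻ G eq))) (^-monoˡ-≤ (suc T) G≤forest)

        -- The count of the forest lies between that of G and the bound, so equality at the ends
        -- collapses both inequalities: G loses no homomorphism, and no star of the forest is below
        -- the bound.
        equality⇒hom≡ : hom G H ≡ hom (forest ks) H
        equality⇒hom≡ = ^-injectiveˡ T (trans (equality⁻ G eq) (≤-antisym uTⁿ≤forest forest≤))

        equality⇒sizes : 0 < u T → All (λ k → u k ^ suc T ≡ u T ^ suc k) ks
        equality⇒sizes 0<uT = hom-forest-≡⁻ H T 0<uT below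
          (trans (≤-antisym forest≤ uTⁿ≤forest) (cong (u T ^_) (sym (↔⇒≡ φ))))

-- Extremal graphs, threshold and tie in terms of `≃` and `starHom`

copies⁺ : (G : SimpleGraph n) (F : SimpleGraph k) → (∃ λ c → G ≃ copies c F) → G IsCopiesOf F
copies⁺ G F (c , i) = c , ≃⇒≅ {F = G} {G = copies c F} i

copies⁻ : (G : SimpleGraph n) (F : SimpleGraph k) → G IsCopiesOf F → ∃ λ c → G ≃ copies c F
copies⁻ G F (c , i) = c , ≅⇒≃ {F = G} {G = copies c F} i

copies-K₂⁺ : (G : SimpleGraph n) → (∃ λ c → G ≃ copies c K[ 1 , 1 ]) → G IsCopiesOf K 2
copies-K₂⁺ G (c , i) = copies⁺ G (K 2) (c , ≃-trans i (copies-cong c (≃-sym K₂≃star)))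

copies-K₂⁻ : (G : SimpleGraph n) → G IsCopiesOf K 2 → ∃ λ c → G ≃ copies c K[ 1 , 1 ]
copies-K₂⁻ G i = let c , j = copies⁻ G (K 2) i in c , ≃-trans j (copies-cong c K₂≃star)

union⁺ : ∀ T (G : SimpleGraph n) → (∃ λ a → ∃ λ b → G ≃ copies a K[ 1 , 1 ] ⊕ copies b K[ 1 , T ]) →
  G IsUnionOfCopiesOf K 2 And K[ 1 , T ]
union⁺ T G (a , b , i) = a , b , ≃⇒≅ {F = G} {G = copies a (K 2) ⊕ copies b K[ 1 , T ]}
  (≃-trans i (⊕-cong (copies-cong a (≃-sym K₂≃star)) (≃-refl {F = copies b K[ 1 , T ]})))

module _ (H : Graph m) where

  private
    u = starHom H

  beats⁻ : ∀ k → StarBeatsEdge H k → u 1 ^ k < u (k ∸ 1) ^ 2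
  beats⁻ k = subst₂ (λ x y → x ^ k < y ^ 2) (hom-K₂ H) (hom-star (k ∸ 1) H)

  beats⁺ : ∀ k → u 1 ^ k < u (k ∸ 1) ^ 2 → StarBeatsEdge H k
  beats⁺ k = subst₂ (λ x y → x ^ k < y ^ 2) (sym (hom-K₂ H)) (sym (hom-star (k ∸ 1) H))

  module _ (n₀ D : ℕ) where

    private
      tieEquation : ∀ {x} → x ≡ n₀ ∸ 1 → x ∸ 1 ≡ n₀ ∸ 2
      tieEquation eq = trans (cong pred eq) (pred[m∸n]≡m∸[1+n] n₀ 1)

    tie⁻ : Tie H n₀ D → u 1 ^ suc D ≡ u D ^ 2
    tie⁻ (eq , tie) = subst₂ (λ k l → u 1 ^ k ≡ u l ^ 2) (sym eq) (sym (tieEquation eq))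
      (subst₂ (λ x y → x ^ (n₀ ∸ 1) ≡ y ^ 2) (hom-K₂ H) (hom-star (n₀ ∸ 2) H) tie)

    tie⁺ : 1 + D ≡ n₀ ∸ 1 → u 1 ^ suc D ≡ u D ^ 2 → Tie H n₀ D
    tie⁺ eq tie = eq , subst₂ (λ x y → x ^ (n₀ ∸ 1) ≡ y ^ 2) (sym (hom-K₂ H)) (sym (hom-star (n₀ ∸ 2) H))
      (subst₂ (λ k l → u 1 ^ k ≡ u l ^ 2) eq (tieEquation eq) tie)

-- The bound and its cases of equality for a fixed graph G

module Main {m : ℕ} (H : Graph m) (noIsolated : NoIsolated H) (D : ℕ) (1≤D : 1 ≤ D)
            (n : ℕ) (G : SimpleGraph n) (G∈𝒢 : 𝒢 n 1 D G) where

  private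
    u = starHom H

  open Roots u

  private
    degG≤D : ∀ v → degree (graph G) v ≤ D
    degG≤D v = ≤-trans (degree≤maxDegree (graph G) v) (proj₂ G∈𝒢)

    spanning : ∃ λ ks → All (1 ≤_) ks × Σ (Fin (size ks) ↔ Fin n) (PreservesAdj (graph (forest ks)) (graph G))
    spanning = spanningForest G λ v → 0<degree⇒neighbour (graph G) v (proj₁ (proj₁ G∈𝒢) v)

    ks = proj₁ spanning
    φ = proj₁ (proj₂ (proj₂ spanning))
    φ-adj = proj₂ (proj₂ (proj₂ spanning))

    sizes : All (λ k → 1 ≤ k × k ≤ D) ks
    sizes = All.zip (proj₁ (proj₂ spanning) , forest-degrees ks D λ v →
      ≤-trans (degree-mono (graph (forest ks)) (graph G) φ φ-adj v) (degG≤D (to φ v)))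

  module Nonempty (x₀ : Fin m) where

    open LogConvex (u>0 H noIsolated x₀) (u-convex H noIsolated)

    bound-nonempty : Bounded G H D
    bound-nonempty = [ edgeMax , starMax ]′ (≤-<-connex (u D ^ 2) (u 1 ^ suc D))
      where
      edgeMax : D ⊑ 1 → Bounded G H D
      edgeMax D⊑1 = spanned⇒bounded H D (edge-dominant H D D⊑1) G φ φ-adj (All.map below sizes)
        where
        below : ∀ {k} → 1 ≤ k × k ≤ D → k ⊑ 1
        below {suc k} (_ , k≤D) = [ id , (λ k⊑D → ⊑-trans {suc k} {D} {1} k⊑D D⊑1) ]′ (endpoint-max k D k≤D)

      starMax : 1 ⊏ D → Bounded G H D
      starMax 1⊏D = spanned⇒bounded H D (star-dominant H D (<⇒≤ 1⊏D)) G φ φ-adj (All.map below sizes)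
        where
        below : ∀ {k} → 1 ≤ k × k ≤ D → k ⊑ D
        below {suc k} (_ , k≤D) = [ (λ k⊑1 → ⊑-trans {suc k} {1} {D} k⊑1 (<⇒≤ 1⊏D)) , id ]′ (endpoint-max k D k≤D)

  module EdgeCase {x y : Fin m} (x≁y : ¬ Adj H x y) (Δ²≤u₁ : maxDegree H ^ 2 ≤ u 1) where

    below-edge : ∀ k → 1 ≤ k → k ⊑ 1
    below-edge (suc zero)    _ = ≤-refl
    below-edge (suc (suc j)) _ = <⇒≤ (edge-dominates H noIsolated x≁y Δ²≤u₁ j)

    dominant : Dominant H D 1
    dominant = edge-dominant H D (below-edge D 1≤D)

    equality⇒copies : Equality G H D → G IsCopiesOf K 2
    equality⇒copies eq = copies-K₂⁺ G (proj₁ constant , ≃-trans (≃-sym forest≃G) (proj₂ constant))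
      where
      below = All.map (λ {k} p → below-edge k (proj₁ p)) sizes
      size≡1 : ∀ {k} → (1 ≤ k × k ≤ D) × u k ^ 2 ≡ u 1 ^ suc k → k ≡ 1
      size≡1 {suc zero}    _        = refl
      size≡1 {suc (suc j)} (_ , eq) = contradiction eq (<⇒≢ (edge-dominates H noIsolated x≁y Δ²≤u₁ j))
      ones : All (_≡ 1) ks
      ones = All.zipWith size≡1 (sizes , equality⇒sizes H D dominant G φ φ-adj below eq (u>0 H noIsolated x 1))
      forest≃G = hom-≡⇒≃ (forest ks) G H φ φ-adj
        (forest-separates H (neighbour H noIsolated) x≁y ks (All.map inj₁ ones))
        (equality⇒hom≡ H D dominant G φ φ-adj below eq)
      constant = forest-constant 1 ones

    equality⇔copies : Equality G H D ⇔ G IsCopiesOf K 2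
    equality⇔copies = mk⇔ equality⇒copies (copies⇒equality H D dominant G ∘ copies-K₂⁻ G)

  module ThresholdCase (u₁<Δ² : u 1 < maxDegree H ^ 2) (n₀ : ℕ) (isThreshold : IsThreshold H n₀) where

    private
      x₀ = proj₁ (apex H noIsolated u₁<Δ²)
      open-nbhd = openNeighbourhood H noIsolated u₁<Δ²

    open LogConvex (u>0 H noIsolated x₀) (u-convex H noIsolated)

    private
      N : ℕ
      N = n₀ ∸ 3

      n₀≡3+N : n₀ ≡ suc (suc (suc N))
      n₀≡3+N = sym (m+[n∸m]≡n (proj₁ isThreshold))

      convex< : ∀ k → u (suc k) ^ 2 < u k * u (suc (suc k))
      convex< = u-convex-< H noIsolated (proj₂ (proj₂ (unequal-degrees H noIsolated u₁<Δ²)))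

      1⊏n₀-1 : 1 ⊏ suc (suc N)
      1⊏n₀-1 = subst (λ k → u 1 ^ k < u (k ∸ 1) ^ 2) n₀≡3+N (beats⁻ H n₀ (proj₁ (proj₂ isThreshold)))

      below-threshold : ∀ k → 1 ≤ k → suc k < n₀ → k ⊑ 1
      below-threshold (suc zero)        _ _ = ≤-refl
      below-threshold k@(suc (suc _)) _ k<n₀ = ≮⇒≥ λ 1⊏k → <⇒≱ k<n₀
        (proj₂ (proj₂ isThreshold) (suc k) (s≤s (s≤s (s≤s z≤n))) (beats⁺ H (suc k) 1⊏k))

      minimal : suc N ⊑ 1
      minimal = below-threshold (suc N) (s≤s z≤n) (≤-reflexive (sym n₀≡3+N))

      forest≃G : hom G H ≡ hom (forest ks) H → forest ks ≃ G
      forest≃G = let _ , _ , _ , _ , _ , x≁y = open-nbhd in hom-≡⇒≃ (forest ks) G H φ φ-adj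
        (forest-separates H (neighbour H noIsolated) x≁y ks (All.universal (λ _ → inj₂ open-nbhd) ks))

    module Below (D<n₀ : 1 + D < n₀) where

      dominant : Dominant H D 1
      dominant = edge-dominant H D (below-threshold D 1≤D D<n₀)

      private
        below : All (_⊑ 1) ks
        below = All.map (λ {k} (1≤k , k≤D) → below-threshold k 1≤k (≤-<-trans (s≤s k≤D) D<n₀)) sizes

        -- Let k ≥ 2. If k + 2 < n₀, then size k + 1 still does not beat the edge, and strict
        -- convexity puts k strictly below it. Otherwise n₀ ≤ k + 2 ≤ D + 2 ≤ n₀, so k = D = n₀ - 2
        -- and the equality is the tie.
        size-or-tie : ∀ {k} → (1 ≤ k × k ≤ D) × u k ^ 2 ≡ u 1 ^ suc k → k ≡ 1 ⊎ (k ≡ D × Tie H n₀ D)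
        size-or-tie {suc zero}    _ = inj₁ refl
        size-or-tie {suc (suc j)} ((_ , k≤D) , eq) with suc (suc (suc (suc j))) <? n₀
        ... | yes k+2<n₀ = contradiction eq (<⇒≢
          (strictly-below-edge j (convex< (suc j)) (below-threshold (suc (suc (suc j))) (s≤s z≤n) k+2<n₀)))
        ... | no ¬k+2<n₀ = inj₂ (k≡D , tie⁺ H n₀ D 1+D≡n₀-1
          (trans (cong (λ k → u 1 ^ suc k) (sym k≡D)) (trans (sym eq) (cong (λ k → u k ^ 2) k≡D))))
          where
          k≡D : suc (suc j) ≡ D
          k≡D = ≤-antisym k≤D (s≤s⁻¹ (s≤s⁻¹ (≤-trans D<n₀ (≮⇒≥ ¬k+2<n₀))))
          1+D≡n₀-1 : 1 + D ≡ n₀ ∸ 1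
          1+D≡n₀-1 = cong pred (≤-antisym D<n₀ (≤-trans (≮⇒≥ ¬k+2<n₀) (s≤s (s≤s k≤D))))

        module _ (eq : Equality G H D) where

          sizes-or-tie : All (λ k → k ≡ 1 ⊎ (k ≡ D × Tie H n₀ D)) ks
          sizes-or-tie = All.zipWith size-or-tie (sizes , equality⇒sizes H D dominant G φ φ-adj below eq (u>0 H noIsolated x₀ 1))

          G≃forest : G ≃ forest ks
          G≃forest = ≃-sym (forest≃G (equality⇒hom≡ H D dominant G φ φ-adj below eq))

      edges⇒equality : G IsCopiesOf K 2 → Equality G H D
      edges⇒equality = copies⇒equality H D dominant G ∘ copies-K₂⁻ G

      untied : ¬ Tie H n₀ D → Equality G H D ⇔ G IsCopiesOf K 2
      untied ¬tie = mk⇔ edges edges⇒equality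
        where
        edges : Equality G H D → G IsCopiesOf K 2
        edges eq =
          let c , i = forest-constant 1 (All.map [ id , (λ (_ , tie) → contradiction tie ¬tie) ]′ (sizes-or-tie eq))
          in copies-K₂⁺ G (c , ≃-trans (G≃forest eq) i)

      stars⇒equality : Tie H n₀ D → G IsCopiesOf K[ 1 , D ] → Equality G H D
      -- A tie gives `1 ⊑ D` as well, so the entry of K[1,D] also attains the maximum in
      -- `boundPower`.
      stars⇒equality tie = copies⇒equality H D (star-dominant H D (≤-reflexive (tie⁻ H n₀ D tie))) G ∘ copies⁻ G K[ 1 , D ]

      equality⇒union : Equality G H D → G IsUnionOfCopiesOf K 2 And K[ 1 , D ]
      equality⇒union eq =
        let a , b , i = forest-two-sizes 1 D (All.map (Sum.map₂ proj₁) (sizes-or-tie eq))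
        in union⁺ D G (a , b , ≃-trans (G≃forest eq) i)

    module Above (n₀≤1+D : n₀ ≤ 1 + D) where

      private
        N+2≤D : suc (suc N) ≤ D
        N+2≤D = s≤s⁻¹ (≤-trans (≤-reflexive (sym n₀≡3+N)) n₀≤1+D)

        below-star : ∀ k → suc k < D → suc k ⊏ D
        below-star = strictly-below-star N 1⊏n₀-1 minimal D N+2≤D

        below : All (_⊑ D) ks
        below = All.map ⊑-star sizes
          where
          ⊑-star : ∀ {k} → 1 ≤ k × k ≤ D → k ⊑ D
          ⊑-star {suc k} (_ , k≤D) =
            [ <⇒≤ ∘ below-star k , (λ k≡D → subst (_⊑ D) (sym k≡D) (⊑-refl {D})) ]′ (m≤n⇒m<n∨m≡n k≤D)

        size≡D : ∀ {k} → (1 ≤ k × k ≤ D) × u k ^ suc D ≡ u D ^ suc k → k ≡ D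
        size≡D {suc k} ((_ , k≤D) , eq) = [ (λ k<D → contradiction eq (<⇒≢ (below-star k k<D))) , id ]′ (m≤n⇒m<n∨m≡n k≤D)

      dominant : Dominant H D D
      dominant = star-dominant H D (<⇒≤ (edge-below N 1⊏n₀-1 minimal D N+2≤D))

      equality⇒copies : Equality G H D → G IsCopiesOf K[ 1 , D ]
      equality⇒copies eq =
        let c , i = forest-constant D (All.zipWith size≡D (sizes , equality⇒sizes H D dominant G φ φ-adj below eq (u>0 H noIsolated x₀ D)))
        in copies⁺ G K[ 1 , D ] (c , ≃-trans (≃-sym (forest≃G (equality⇒hom≡ H D dominant G φ φ-adj below eq))) i)

      equality⇔copies : Equality G H D ⇔ G IsCopiesOf K[ 1 , D ]
      equality⇔copies = mk⇔ equality⇒copies (copies⇒equality H D dominant G ∘ copies⁻ G K[ 1 , D ])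

hom-empty : (G : SimpleGraph n) (H : Graph 0) → Fin n → hom G H ≡ 0
hom-empty {suc n} G H _ = refl

bound : (H : Graph m) → NoIsolated H → ∀ D → 1 ≤ D → ∀ n (G : SimpleGraph n) → 𝒢 n 1 D G → Bounded G H D
-- The minimum degree of G is attained, so G has a vertex and there is no map into an empty H.
bound {zero} H noIsolated D 1≤D n G G∈𝒢 =
  subst (λ x → x ^ (2 * (1 + D)) ≤ boundPower H n D) (sym (hom-empty G H (proj₁ (proj₂ (proj₁ G∈𝒢))))) z≤n
bound {suc m} H noIsolated D 1≤D n G G∈𝒢 = Main.Nonempty.bound-nonempty H noIsolated D 1≤D n G G∈𝒢 zero

theorem1p8 : ∀ {m} (H : Graph m) → NoIsolated H →
    ∀ (D : ℕ) → 1 ≤ D →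
    ∀ (n : ℕ) (G : SimpleGraph n) → 𝒢 n 1 D G →
    Bounded G H D
    × ( ¬ (H ≅ Kˡᵒᵒᵖ (maxDegree H)) → maxDegree H ^ 2 ≤ hom (K 2) H →
    Equality G H D ⇔ G IsCopiesOf K 2 )
    × ( hom (K 2) H < maxDegree H ^ 2 →
    ∃ λ n₀ → IsThreshold H n₀
    × ( 1 + D < n₀ →
    (¬ Tie H n₀ D → Equality G H D ⇔ G IsCopiesOf K 2)
    × (Tie H n₀ D →
    (G IsCopiesOf K 2 → Equality G H D)
    × (G IsCopiesOf K[ 1 , D ] → Equality G H D)
    × (Equality G H D → G IsUnionOfCopiesOf K 2 And K[ 1 , D ])) )
    × ( n₀ ≤ 1 + D →
    Equality G H D ⇔ G IsCopiesOf K[ 1 , D ] ) )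
theorem1p8 H noIsolated D 1≤D n G G∈𝒢 =
  bound H noIsolated D 1≤D n G G∈𝒢 ,
  -- An H in which all pairs, loops included, are adjacent has Δ vertices and would be the excluded
  -- graph; the non-adjacent pair found here may be a single unlooped vertex.
  (λ H≇K Δ²≤K₂ → EdgeCase.equality⇔copies
    (proj₂ (proj₂ (nonAdjacentPair H (H≇K ∘ complete⇒≅Kˡᵒᵒᵖ H))))
    (subst (maxDegree H ^ 2 ≤_) (hom-K₂ H) Δ²≤K₂)) ,
  λ K₂<Δ² →
    let u₁<Δ² = subst (_< maxDegree H ^ 2) (hom-K₂ H) K₂<Δ²
        n₀ , isThreshold = threshold H noIsolated u₁<Δ²
        module Case = ThresholdCase u₁<Δ² n₀ isThreshold
    in n₀ , isThreshold ,
      (λ D<n₀ → Case.Below.untied D<n₀ ,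
        λ tie → Case.Below.edges⇒equality D<n₀ , Case.Below.stars⇒equality D<n₀ tie , Case.Below.equality⇒union D<n₀) ,
      Case.Above.equality⇔copies
  where open Main H noIsolated D 1≤D n G G∈𝒢
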